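{- Let $t\ge 1$ be an integer and let $G$ be a finite graph without an induced matching of size $t$. Then $h(G)\le 10\,t^t\,\omega(G)^{3t-3}\log\omega(G)$.
   Context: For a graph $G$, $\omega(G)$ denotes its clique number, and $h(G)$ denotes the smallest size of a subset of $V(G)$ that intersects every maximum independent set of $G$ (an independent set of size $\alpha(G)$, the independence number). An induced matching of size $t$ in $G$ consists of vertices $a_1,b_1,\dots,a_t,b_t$ such that the subgraph of $G$ induced on $\{a_i,b_i\}_{i\in[t]}$ has edge set exactly $\{a_ib_i : i\in[t]\}$. $\log$ denotes the natural logarithm.
   Formalization: The graph is assumed to have an edge (ω(G) ≥ 2): for a nonempty edgeless graph ω(G) = 1, so the bound is 0 while h(G) = 1, and for the empty graph h(G) and log 0 are undefined. -}

module Defs where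

open import Data.Nat as ℕ using (ℕ; zero; suc; _∸_)
import Data.Nat.Properties as ℕ
open import Data.Integer as ℤ using (+_)
import Data.Integer.Properties as ℤ
open import Data.Rational as ℚ using (ℚ; mkℚ; 0ℚ; 1ℚ; _/_; ∣_∣; toℚᵘ; fromℚᵘ)
import Data.Rational.Properties as ℚ
open import Data.Rational.Unnormalised as ℚᵘ using (mkℚᵘ; *≡*; *≤*; *<*)
import Data.Rational.Unnormalised.Properties as ℚᵘ
open import Algebra.Properties.Group ℚ.+-0-group using (⁻¹-involutive)
open import Data.Fin using (Fin)
open import Data.Fin.Subset as Subset using (Subset; _∈_; _∩_; Nonempty)
open import Data.Product using (∃; _×_; _,_)
open import Data.Sum using (_⊎_; inj₁; inj₂; [_,_])
open import Function.Bundles using (_⇔_)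
open import Function.Definitions using (Injective)
open import Level using (0ℓ)
open import Relation.Binary.Core using (Rel)
open import Relation.Binary.Definitions using (Symmetric; Irreflexive; Decidable)
open import Relation.Binary.PropositionalEquality
  using (_≡_; _≢_; refl; sym; trans; cong; cong₂; subst; subst₂)
open import Relation.Nullary using (¬_)

------------------------------------------------------------------------
-- Finite simple graphs

record Graph (n : ℕ) : Set₁ where
  field
    _~_     : Rel (Fin n) 0ℓ
    ~-sym   : Symmetric _~_
    ~-irrefl : Irreflexive _≡_ _~_
    _~?_    : Decidable _~_

IsMaxSize IsMinSize : ∀ {n} → (Subset n → Set) → ℕ → Set
IsMaxSize P k = (∃ λ S → P S × Subset.∣ S ∣ ≡ k) × (∀ S → P S → Subset.∣ S ∣ ℕ.≤ k)
IsMinSize P k = (∃ λ S → P S × Subset.∣ S ∣ ≡ k) × (∀ S → P S → k ℕ.≤ Subset.∣ S ∣)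

module _ {n : ℕ} (G : Graph n) where
  open Graph G

  IsClique : Subset n → Set
  IsClique S = ∀ u v → u ∈ S → v ∈ S → u ≢ v → u ~ v

  IsIndependent : Subset n → Set
  IsIndependent S = ∀ u v → u ∈ S → v ∈ S → ¬ (u ~ v)

  -- The invariants ω(G), α(G) and h(G) are given as relations "k is the
  -- value of the invariant"; each holds for at most one k.  On the graph
  -- without vertices h is undefined: the empty set is then a maximum
  -- independent set, which nothing intersects.

  IsCliqueNumber : ℕ → Set
  IsCliqueNumber = IsMaxSize IsClique

  IsIndependenceNumber : ℕ → Set
  IsIndependenceNumber = IsMaxSize IsIndependent

  IsMaximumIndependent : Subset n → Set
  IsMaximumIndependent S = IsIndependent S × IsIndependenceNumber Subset.∣ S ∣

  HitsMaximumIndependents : Subset n → Set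
  HitsMaximumIndependents X = ∀ S → IsMaximumIndependent S → Nonempty (X ∩ S)

  IsHittingNumber : ℕ → Set
  IsHittingNumber = IsMinSize HitsMaximumIndependents

  record InducedMatching (t : ℕ) : Set where
    field
      a b : Fin t → Fin n

    vertex : Fin t ⊎ Fin t → Fin n
    vertex = [ a , b ]

    field
      distinct : Injective _≡_ _≡_ vertex
      edges    : ∀ x y → vertex x ~ vertex y ⇔
                 (∃ λ i → (vertex x ≡ a i × vertex y ≡ b i) ⊎
                          (vertex x ≡ b i × vertex y ≡ a i))

------------------------------------------------------------------------
-- Real numbers, as Cauchy sequences of rationals

record ℝ : Set where
  field
    seq    : ℕ → ℚ
    cauchy : ∀ ε → 0ℚ ℚ.< ε →
             ∃ λ N → ∀ i j → N ℕ.≤ i → N ℕ.≤ j → ∣ seq i ℚ.- seq j ∣ ℚ.< ε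

open ℝ

infix 4 _≤ℝ_

_≤ℝ_ : ℝ → ℝ → Set
x ≤ℝ y = ∀ ε → 0ℚ ℚ.< ε → ∃ λ N → ∀ i → N ℕ.≤ i → seq x i ℚ.≤ seq y i ℚ.+ ε

fromℕ : ℕ → ℝ
fromℕ k .seq _ = + k / 1
fromℕ k .cauchy ε 0<ε = 0 , λ _ _ _ _ →
  subst (ℚ._< ε) (sym (cong ∣_∣ (ℚ.+-inverseʳ (+ k / 1)))) 0<ε

module ℚ-Lemmas where
  pos-suc : ∀ k → ℚ.Positive (+ suc k / 1)
  pos-suc k = ℚ.normalize-pos (suc k) 1

  pos-recip : ∀ k → ℚ.Positive (+ 1 / suc k)
  pos-recip k = ℚ.normalize-pos 1 (suc k)

  nonNeg-fromℕ : ∀ k → ℚ.NonNegative (+ k / 1)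
  nonNeg-fromℕ k = ℚ.normalize-nonNeg k 1

  fromℚᵘ-mono-≤ : ∀ p q → p ℚᵘ.≤ q → fromℚᵘ p ℚ.≤ fromℚᵘ q
  fromℚᵘ-mono-≤ p q p≤q = ℚ.toℚᵘ-cancel-≤
    (ℚᵘ.≤-respˡ-≃ (ℚᵘ.≃-sym (ℚ.toℚᵘ-fromℚᵘ p))
      (ℚᵘ.≤-respʳ-≃ (ℚᵘ.≃-sym (ℚ.toℚᵘ-fromℚᵘ q)) p≤q))

  fromℚᵘ-homo-* : ∀ p q → fromℚᵘ p ℚ.* fromℚᵘ q ≡ fromℚᵘ (p ℚᵘ.* q)
  fromℚᵘ-homo-* p q = ℚ.toℚᵘ-injective
    (ℚᵘ.≃-trans (ℚ.toℚᵘ-homo-* (fromℚᵘ p) (fromℚᵘ q))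
      (ℚᵘ.≃-trans (ℚᵘ.*-cong (ℚ.toℚᵘ-fromℚᵘ p) (ℚ.toℚᵘ-fromℚᵘ q))
        (ℚᵘ.≃-sym (ℚ.toℚᵘ-fromℚᵘ (p ℚᵘ.* q)))))

  suc*recip : ∀ b i → (+ suc b / 1) ℚ.* (+ 1 / suc (b ℕ.+ i ℕ.* suc b)) ≡ + 1 / suc i
  suc*recip b i = trans (fromℚᵘ-homo-* (mkℚᵘ (+ suc b) 0) (mkℚᵘ (+ 1) (b ℕ.+ i ℕ.* suc b)))
    (ℚ.fromℚᵘ-cong
      {mkℚᵘ (+ suc b) 0 ℚᵘ.* mkℚᵘ (+ 1) (b ℕ.+ i ℕ.* suc b)} {mkℚᵘ (+ 1) i}
      (*≡* (cong +_ eq)))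
    where
    eq : suc b ℕ.* 1 ℕ.* suc i ≡ 1 ℕ.* (1 ℕ.* suc (b ℕ.+ i ℕ.* suc b))
    eq = trans (cong (ℕ._* suc i) (ℕ.*-identityʳ (suc b)))
      (trans (ℕ.*-comm (suc b) (suc i))
        (sym (trans (ℕ.*-identityˡ _) (ℕ.*-identityˡ _))))

  recip-anti : ∀ {i j} → i ℕ.≤ j → + 1 / suc j ℚ.≤ + 1 / suc i
  recip-anti {i} {j} i≤j = fromℚᵘ-mono-≤ (mkℚᵘ (+ 1) j) (mkℚᵘ (+ 1) i)
    (*≤* (ℤ.*-monoˡ-≤-nonNeg (+ 1) (ℤ.+≤+ (ℕ.s≤s i≤j))))

  archimedean : ∀ ε → 0ℚ ℚ.< ε → ∃ λ N → + 1 / suc N ℚ.< ε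
  archimedean ε@(mkℚ (+ suc p) d _) _ = suc d , ℚ.toℚᵘ-cancel-<
    (ℚᵘ.<-respˡ-≃ (ℚᵘ.≃-sym (ℚ.toℚᵘ-fromℚᵘ (mkℚᵘ (+ 1) (suc d)))) (*<* (ℤ.+<+ lt)))
    where
    lt : 1 ℕ.* suc d ℕ.< suc p ℕ.* suc (suc d)
    lt = ℕ.≤-trans (ℕ.≤-reflexive (cong suc (ℕ.*-identityˡ (suc d))))
                   (ℕ.m≤m+n (suc (suc d)) (p ℕ.* suc (suc d)))
  archimedean (mkℚ (+ zero) _ _) (ℚ.*<* (ℤ.+<+ ()))
  archimedean (mkℚ ℤ.-[1+ _ ] _ _) (ℚ.*<* ())

  p≤q+r⇒p-q≤r : ∀ p q r → p ℚ.≤ r ℚ.+ q → p ℚ.- q ℚ.≤ r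
  p≤q+r⇒p-q≤r p q r le = subst (p ℚ.- q ℚ.≤_)
    (trans (ℚ.+-assoc r q (ℚ.- q)) (trans (cong (r ℚ.+_) (ℚ.+-inverseʳ q)) (ℚ.+-identityʳ r)))
    (ℚ.+-monoˡ-≤ (ℚ.- q) le)

  neg-minus : ∀ p q → ℚ.- (p ℚ.- q) ≡ q ℚ.- p
  neg-minus p q = trans (ℚ.neg-distrib-+ p (ℚ.- q))
    (trans (cong (ℚ.- p ℚ.+_) (⁻¹-involutive q)) (ℚ.+-comm (ℚ.- p) q))

  ∣-∣< : ∀ p q ε → p ℚ.- q ℚ.< ε → q ℚ.- p ℚ.< ε → ∣ p ℚ.- q ∣ ℚ.< ε
  ∣-∣< p q ε l r with ℚ.∣p∣≡p∨∣p∣≡-p (p ℚ.- q)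
  ... | inj₁ e = subst (ℚ._< ε) (sym e) l
  ... | inj₂ e = subst (ℚ._< ε) (sym (trans e (neg-minus p q))) r

open ℚ-Lemmas

infixr 7 _·_

_·_ : ℕ → ℝ → ℝ
(c · x) .seq i = (+ c / 1) ℚ.* seq x i
(c · x) .cauchy ε 0<ε with cauchy x (δ ℚ.* ε) 0<δε
  where
  δ = + 1 / suc c
  0<δε : 0ℚ ℚ.< δ ℚ.* ε
  0<δε = subst (ℚ._< δ ℚ.* ε) (ℚ.*-zeroʳ δ) (ℚ.*-monoʳ-<-pos δ {{pos-recip c}} 0<ε)
... | N , close = N , λ i j N≤i N≤j → ℚ.≤-<-trans
    (ℚ.≤-reflexive (scaled (seq x i) (seq x j)))
    (ℚ.≤-<-trans (ℚ.*-monoʳ-≤-nonNeg ∣ seq x i ℚ.- seq x j ∣ {{ℚ.∣-∣-nonNeg (seq x i ℚ.- seq x j)}} c≤1+c)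
      (subst ((+ suc c / 1) ℚ.* ∣ seq x i ℚ.- seq x j ∣ ℚ.<_) cancel
        (ℚ.*-monoʳ-<-pos (+ suc c / 1) {{pos-suc c}} (close i j N≤i N≤j))))
  where
  C = + c / 1
  c≤1+c : + c / 1 ℚ.≤ + suc c / 1
  c≤1+c = fromℚᵘ-mono-≤ (mkℚᵘ (+ c) 0) (mkℚᵘ (+ suc c) 0)
    (*≤* (ℤ.*-monoʳ-≤-nonNeg (+ 1) (ℤ.+≤+ (ℕ.n≤1+n c))))
  scaled : ∀ p q → ∣ C ℚ.* p ℚ.- C ℚ.* q ∣ ≡ C ℚ.* ∣ p ℚ.- q ∣
  scaled p q = trans
    (cong ∣_∣ (trans (cong (C ℚ.* p ℚ.+_) (ℚ.neg-distribʳ-* C q))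
                     (sym (ℚ.*-distribˡ-+ C p (ℚ.- q)))))
    (trans (ℚ.∣p*q∣≡∣p∣*∣q∣ C (p ℚ.- q))
      (cong (ℚ._* ∣ p ℚ.- q ∣) (ℚ.0≤p⇒∣p∣≡p (ℚ.nonNegative⁻¹ C {{nonNeg-fromℕ c}}))))
  cancel : (+ suc c / 1) ℚ.* ((+ 1 / suc c) ℚ.* ε) ≡ ε
  cancel = trans (sym (ℚ.*-assoc (+ suc c / 1) (+ 1 / suc c) ε))
    (trans (cong (ℚ._* ε) (subst (λ k → (+ suc c / 1) ℚ.* (+ 1 / suc k) ≡ 1ℚ) (ℕ.+-identityʳ c) (suc*recip c 0)))
      (ℚ.*-identityˡ ε))

------------------------------------------------------------------------
-- The natural logarithm of a positive integer

∑ : ℕ → (ℕ → ℚ) → ℚ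
∑ zero    f = 0ℚ
∑ (suc k) f = ∑ k f ℚ.+ f k

-- log m = ∫₁ᵐ dx/x.  With N = suc i, the left Riemann sum over [1 , m] with
-- step 1/N has (m - 1) * N terms, namely (1/N) · 1/(1 + j/N) = 1/(N + j).
-- For m = 0 the truncated subtraction gives the value 0.
logSum : ℕ → ℕ → ℚ
logSum m i = ∑ ((m ∸ 1) ℕ.* suc i) (λ j → + 1 / suc (i ℕ.+ j))

module LogLemmas where
  ∑-cong : ∀ k {f g : ℕ → ℚ} → (∀ j → f j ≡ g j) → ∑ k f ≡ ∑ k g
  ∑-cong zero    e = refl
  ∑-cong (suc k) e = cong₂ ℚ._+_ (∑-cong k e) (e k)

  ∑-mono : ∀ k {f g : ℕ → ℚ} → (∀ j → j ℕ.< k → f j ℚ.≤ g j) → ∑ k f ℚ.≤ ∑ k g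
  ∑-mono zero    le = ℚ.≤-refl
  ∑-mono (suc k) le =
    ℚ.+-mono-≤ (∑-mono k (λ j j<k → le j (ℕ.m<n⇒m<1+n j<k))) (le k (ℕ.n<1+n k))

  ∑-++ : ∀ k l (f : ℕ → ℚ) → ∑ (k ℕ.+ l) f ≡ ∑ k f ℚ.+ ∑ l (λ j → f (k ℕ.+ j))
  ∑-++ k zero f rewrite ℕ.+-identityʳ k = sym (ℚ.+-identityʳ (∑ k f))
  ∑-++ k (suc l) f rewrite ℕ.+-suc k l =
    trans (cong (ℚ._+ f (k ℕ.+ l)) (∑-++ k l f)) (ℚ.+-assoc (∑ k f) _ _)

  ∑-head : ∀ k (f : ℕ → ℚ) → ∑ (suc k) f ≡ f 0 ℚ.+ ∑ k (λ j → f (suc j))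
  ∑-head k f = trans (∑-++ 1 k f) (cong (ℚ._+ ∑ k (λ j → f (suc j))) (ℚ.+-identityˡ (f 0)))

  ∑-const : ∀ k q → ∑ k (λ _ → q) ≡ (+ k / 1) ℚ.* q
  ∑-const zero    q = sym (ℚ.*-zeroˡ q)
  ∑-const (suc k) q = trans (cong₂ ℚ._+_ (∑-const k q) (sym (ℚ.*-identityˡ q)))
    (trans (sym (ℚ.*-distribʳ-+ q (+ k / 1) 1ℚ)) (cong (ℚ._* q) suc≡))
    where
    suc≡ : (+ k / 1) ℚ.+ 1ℚ ≡ + suc k / 1
    suc≡ = ℚ.toℚᵘ-injective
      (ℚᵘ.≃-trans (ℚ.toℚᵘ-homo-+ (+ k / 1) 1ℚ)
        (ℚᵘ.≃-trans (ℚᵘ.+-congˡ _ (ℚ.toℚᵘ-fromℚᵘ (mkℚᵘ (+ k) 0)))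
          (ℚᵘ.≃-trans (*≡* {mkℚᵘ (+ k) 0 ℚᵘ.+ mkℚᵘ (+ 1) 0} {mkℚᵘ (+ suc k) 0} num)
            (ℚᵘ.≃-sym (ℚ.toℚᵘ-fromℚᵘ (mkℚᵘ (+ suc k) 0))))))
      where
      num : (+ k ℤ.* + 1 ℤ.+ + 1) ℤ.* + 1 ≡ + suc k ℤ.* + 1
      num = cong (ℤ._* + 1) (trans (cong (ℤ._+ + 1) (ℤ.*-identityʳ (+ k)))
        (cong +_ (ℕ.+-comm k 1)))

  -- Refining the step from 1/(a+1) to 1/((a+1)(b+1)).
  module Refine (a b : ℕ) where
    fine : ℕ
    fine = b ℕ.+ a ℕ.* suc b

    H : ℕ → ℕ → ℚ
    H i k = ∑ k (λ j → + 1 / suc (i ℕ.+ j))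

    reindex : ∀ c j → fine ℕ.+ (c ℕ.* suc b ℕ.+ j) ≡ (b ℕ.+ (a ℕ.+ c) ℕ.* suc b) ℕ.+ j
    reindex c j = trans (sym (ℕ.+-assoc fine (c ℕ.* suc b) j))
      (cong (ℕ._+ j) (trans (ℕ.+-assoc b (a ℕ.* suc b) (c ℕ.* suc b))
        (cong (b ℕ.+_) (sym (ℕ.*-distribʳ-+ (suc b) a c)))))

    block : ℕ → ℚ
    block c = ∑ (suc b) (λ j → + 1 / suc (fine ℕ.+ (c ℕ.* suc b ℕ.+ j)))

    block≤ : ∀ c → block c ℚ.≤ + 1 / suc (a ℕ.+ c)
    block≤ c = ℚ.≤-trans
      (∑-mono (suc b) (λ j _ → recip-anti
        (subst (b ℕ.+ (a ℕ.+ c) ℕ.* suc b ℕ.≤_) (sym (reindex c j)) (ℕ.m≤m+n _ j))))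
      (ℚ.≤-reflexive (trans (∑-const (suc b) _) (suc*recip b (a ℕ.+ c))))

    block≥ : ∀ c → + 1 / suc (suc a ℕ.+ c) ℚ.≤ block c
    block≥ c = ℚ.≤-trans
      (ℚ.≤-reflexive (sym (trans (∑-const (suc b) _) (suc*recip b (suc a ℕ.+ c)))))
      (∑-mono (suc b) (λ j j<b → recip-anti
        (subst (ℕ._≤ b ℕ.+ (suc a ℕ.+ c) ℕ.* suc b) (sym (reindex c j)) (bound j j<b))))
      where
      bound : ∀ j → j ℕ.< suc b →
              (b ℕ.+ (a ℕ.+ c) ℕ.* suc b) ℕ.+ j ℕ.≤ b ℕ.+ (suc b ℕ.+ (a ℕ.+ c) ℕ.* suc b)
      bound j j<b = subst (ℕ._≤ b ℕ.+ (suc b ℕ.+ (a ℕ.+ c) ℕ.* suc b))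
        (sym (ℕ.+-assoc b ((a ℕ.+ c) ℕ.* suc b) j))
        (ℕ.+-monoʳ-≤ b (subst (ℕ._≤ suc b ℕ.+ (a ℕ.+ c) ℕ.* suc b)
          (ℕ.+-comm j ((a ℕ.+ c) ℕ.* suc b)) (ℕ.+-monoˡ-≤ ((a ℕ.+ c) ℕ.* suc b) (ℕ.<⇒≤ j<b))))

    split : ∀ c → H fine (suc c ℕ.* suc b) ≡ H fine (c ℕ.* suc b) ℚ.+ block c
    split c = trans (cong (H fine) (ℕ.+-comm (suc b) (c ℕ.* suc b)))
      (∑-++ (c ℕ.* suc b) (suc b) (λ j → + 1 / suc (fine ℕ.+ j)))

    upper : ∀ c → H fine (c ℕ.* suc b) ℚ.≤ H a c
    upper zero    = ℚ.≤-refl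
    upper (suc c) = ℚ.≤-trans (ℚ.≤-reflexive (split c)) (ℚ.+-mono-≤ (upper c) (block≤ c))

    lower : ∀ c → H (suc a) c ℚ.≤ H fine (c ℕ.* suc b)
    lower zero    = ℚ.≤-refl
    lower (suc c) = ℚ.≤-trans (ℚ.+-mono-≤ (lower c) (block≥ c)) (ℚ.≤-reflexive (sym (split c)))

    shift : ∀ c → H a c ℚ.≤ (+ 1 / suc a) ℚ.+ H (suc a) c
    shift c = ℚ.≤-trans
      (ℚ.≤-trans (ℚ.≤-reflexive (sym (ℚ.+-identityʳ (H a c))))
        (ℚ.+-monoʳ-≤ (H a c) (ℚ.<⇒≤ (ℚ.positive⁻¹ (+ 1 / suc (a ℕ.+ c)) {{pos-recip (a ℕ.+ c)}}))))
      (ℚ.≤-reflexive (trans (∑-head c (λ j → + 1 / suc (a ℕ.+ j)))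
        (cong₂ ℚ._+_ (cong (λ k → + 1 / suc k) (ℕ.+-identityʳ a))
          (∑-cong c (λ j → cong (λ k → + 1 / suc k) (ℕ.+-suc a j))))))

  module _ (m : ℕ) where
    fine-upper : ∀ a b → logSum m (b ℕ.+ a ℕ.* suc b) ℚ.≤ logSum m a
    fine-upper a b = subst (λ k → H fine k ℚ.≤ logSum m a)
      (ℕ.*-assoc (m ∸ 1) (suc a) (suc b)) (upper ((m ∸ 1) ℕ.* suc a))
      where open Refine a b

    fine-lower : ∀ a b → logSum m a ℚ.≤ (+ 1 / suc a) ℚ.+ logSum m (b ℕ.+ a ℕ.* suc b)
    fine-lower a b = ℚ.≤-trans (shift ((m ∸ 1) ℕ.* suc a))
      (ℚ.+-monoʳ-≤ (+ 1 / suc a) (subst (λ k → H (suc a) ((m ∸ 1) ℕ.* suc a) ℚ.≤ H fine k)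
        (ℕ.*-assoc (m ∸ 1) (suc a) (suc b)) (lower ((m ∸ 1) ℕ.* suc a))))
      where open Refine a b

    logSum-diff : ∀ a b → logSum m a ℚ.- logSum m b ℚ.≤ + 1 / suc a
    logSum-diff a b = p≤q+r⇒p-q≤r (logSum m a) (logSum m b) (+ 1 / suc a)
      (ℚ.≤-trans (fine-lower a b) (ℚ.+-monoʳ-≤ (+ 1 / suc a)
        (subst (λ k → logSum m k ℚ.≤ logSum m b)
          (ℕ.suc-injective (ℕ.*-comm (suc b) (suc a))) (fine-upper b a))))

open LogLemmas

log : ℕ → ℝ
log m .seq = logSum m
log m .cauchy ε 0<ε with archimedean ε 0<ε
... | N , 1/N<ε = N , λ i j N≤i N≤j → ∣-∣< (logSum m i) (logSum m j) ε
    (ℚ.≤-<-trans (ℚ.≤-trans (logSum-diff m i j) (recip-anti N≤i)) 1/N<ε)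
    (ℚ.≤-<-trans (ℚ.≤-trans (logSum-diff m j i) (recip-anti N≤j)) 1/N<ε)

{-# OPTIONS --safe #-}

-- Let s = t - 1.  The vertices fall into at most ω² classes according to two non-neighbours in
-- a maximum clique, and by induction on t (Wagon) n ≤ D α with D = ω^(2s).  If a set S of
-- vertices is shattered by the maximum independent sets, then S is independent and each w ∈ S
-- has a private neighbour, taken in a maximum independent set that meets S in S ∖ {w};
-- Ramsey's theorem for the private neighbours gives |S| ≤ d with d = s ω^s.
--
-- Suppose every sample Z of m vertices misses a maximum independent set I.  Double sampling
-- needs no tail bounds here: average 2^|Z′ ∩ I| over a ghost sample Z′ of m vertices.  For a
-- fixed I missing Z the average is (1 + α/n)^m ≥ (1 + 1/D)^m, while by symmetry under
-- exchanging the i-th entries of Z and Z′ each trace of a maximum independent set on (Z , Z′),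
-- weighted by 2^|Z′ ∩ I| if it misses Z and by 0 otherwise, contributes at most 1 on average,
-- and by Sauer–Shelah there are at most (1 + 2m)^d traces. For m = D d q with 1 + 2m < 2^q
-- this is contradictory, so h ≤ m; with ℓ = ⌊log₂ ω⌋ the choice q = 20 s ℓ suffices, and log ω
-- ≥ ℓ/2.

module Submission where

open import Defs
open import Data.Bool using (Bool; true; false; if_then_else_)
import Data.Bool.Properties as Bool
open import Data.Fin using (Fin; zero; suc)
import Data.Fin.Properties as Fin
open import Data.Fin.Subset using (Subset; inside; outside; ∣_∣; _∩_)
  renaming (_∈_ to _∈ₛ_; _∉_ to _∉ₛ_; ⊥ to ∅)
open import Data.Fin.Subset.Properties
  using (_∈?_; ∉⊥; ∣⊥∣≡0; ∣p∣≤n; drop-there; anySubset?; nonempty?; x∈p∩q⁺)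
import Data.Integer as ℤ
import Data.Integer.Properties as ℤ
open import Data.List
  using (List; []; _∷_; _++_; length; filter; lookup; map; tabulate; allFin; cartesianProduct; cartesianProductWith)
open import Data.List.Properties using (length-++; length-map; length-tabulate; map-++; map-∘; map-tabulate)
open import Data.List.Membership.Propositional using (_∈_; find; lose)
open import Data.List.Membership.Propositional.Properties
  using (∈-∃++; ∈-cartesianProduct⁺; ∈-cartesianProduct⁻; ∈-cartesianProductWith⁺; ∈-filter⁻; ∈-lookup; ∈-tabulate⁺)
open import Data.List.Relation.Binary.Permutation.Propositional using (↭⇒↭ₛ; ↭-sym)
open import Data.List.Relation.Binary.Permutation.Propositional.Properties
  using (shift; All-resp-↭; ∈-resp-↭; ↭-length)
open import Data.List.Relation.Binary.Permutation.Setoid.Properties using (AllPairs-resp-↭)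
open import Data.List.Relation.Unary.All as All using (All; []; _∷_; all?)
open import Data.List.Relation.Unary.All.Properties using (all-filter; ¬All⇒Any¬)
  renaming (filter⁺ to All-filter⁺; map⁺ to All-map⁺)
open import Data.List.Relation.Unary.AllPairs as AllPairs using (AllPairs; []; _∷_)
open import Data.List.Relation.Unary.AllPairs.Properties using ()
  renaming (filter⁺ to AllPairs-filter⁺; map⁺ to AllPairs-map⁺)
open import Data.List.Relation.Unary.Any using (Any; here; there)
open import Data.List.Relation.Unary.Unique.Propositional using (Unique)
open import Data.List.Relation.Unary.Unique.Propositional.Properties using (allFin⁺)
open import Data.Nat
  using (ℕ; zero; suc; _≤_; _<_; _+_; _*_; _^_; _∸_; z≤n; s≤s; s≤s⁻¹; NonZero; >-nonZero; ≢-nonZero⁻¹; _≤?_; _<?_)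
open import Data.Nat.ListAction using (sum)
open import Data.Nat.ListAction.Properties using (sum-++)
open import Data.Nat.Properties
open import Data.Nat.Solver using (module +-*-Solver)
open import Data.Product using (∃; _×_; _,_; proj₁; proj₂)
open import Data.Rational as ℚ using (0ℚ; ½; _/_)
import Data.Rational.Properties as ℚ
open import Data.Rational.Unnormalised as ℚᵘ using (mkℚᵘ; *≤*)
open import Data.Sum as Sum using (_⊎_; inj₁; inj₂; [_,_])
open import Data.Vec as Vec using (Vec; []; _∷_; _[_]≔_; here; there)
import Data.Vec.Properties as Vec
open import Function using (_∘_)
open import Function.Bundles using (mk⇔)
open import Level using (0ℓ)
open import Relation.Binary.Core using (Rel)
open import Relation.Binary.Definitions using (Symmetric) renaming (Decidable to Decidable₂)
open import Relation.Binary.PropositionalEquality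
  using (_≡_; _≢_; refl; sym; trans; cong; cong₂; subst; subst₂; setoid; respˡ; respʳ; module ≡-Reasoning)
open import Relation.Nullary
  using (¬_; Dec; yes; no; does; contradiction; ¬?; _×-dec_; _⊎-dec_; _→-dec_; decidable-stable)
open import Relation.Nullary.Decidable using (map′; does-⇔; dec-true)
open import Relation.Unary using (Decidable)
open import Relation.Unary.Properties using (∁?)
open ℚ-Lemmas
open LogLemmas

-- Lists and Ramsey's theorem

module _ {A : Set} {P : A → Set} (P? : Decidable P) where

  length-filter-∁ : ∀ xs → length (filter P? xs) + length (filter (∁? P?) xs) ≡ length xs
  length-filter-∁ [] = refl
  length-filter-∁ (x ∷ xs) with P? x
  ... | yes _ = cong suc (length-filter-∁ xs)
  ... | no  _ = trans (+-suc _ _) (cong suc (length-filter-∁ xs))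

  length-filter-filter : ∀ {Q : A → Set} (Q? : Decidable Q) xs →
    length (filter Q? (filter P? xs)) ≤ length (filter Q? xs)
  length-filter-filter Q? [] = z≤n
  length-filter-filter Q? (x ∷ xs) with P? x | Q? x in eq
  ... | yes _ | yes _ rewrite eq = s≤s (length-filter-filter Q? xs)
  ... | yes _ | no  _ rewrite eq = length-filter-filter Q? xs
  ... | no  _ | yes _ = m≤n⇒m≤1+n (length-filter-filter Q? xs)
  ... | no  _ | no  _ = length-filter-filter Q? xs

-- Induction on `cs`: the entries related to `c` are split off, and every remaining entry is still
-- covered by the rest of `cs`.
length-cover : ∀ {C A : Set} {R : C → A → Set} (R? : ∀ c → Decidable (R c)) {b} cs xs →
  All (λ x → Any (λ c → R c x) cs) xs →
  All (λ c → length (filter (R? c) xs) ≤ b) cs → length xs ≤ length cs * b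
length-cover R? []       []       _        _        = z≤n
length-cover R? []       (_ ∷ _)  (() ∷ _) _
length-cover {R = R} R? {b} (c ∷ cs) xs cov (le ∷ les) = begin
  length xs                                          ≡⟨ length-filter-∁ (R? c) xs ⟨
  length (filter (R? c) xs) + length rest            ≤⟨ +-mono-≤ le (length-cover R? cs rest cov′ les′) ⟩
  b + length cs * b                                  ∎
  where
  open ≤-Reasoning
  rest = filter (∁? (R? c)) xs
  tail : ∀ {x} → Any (λ c → R c x) (c ∷ cs) × ¬ R c x → Any (λ c → R c x) cs
  tail (here r , ¬r) = contradiction r ¬r
  tail (there a , _) = a
  cov′ = All.map tail (All.zip (All-filter⁺ (∁? (R? c)) cov , all-filter (∁? (R? c)) xs))
  les′ = All.map (≤-trans (length-filter-filter (∁? (R? c)) (R? _) xs)) les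

AllPairs-lookup : ∀ {A : Set} {R : Rel A 0ℓ} → Symmetric R → ∀ {xs} → AllPairs R xs →
  ∀ {i j} → i ≢ j → R (lookup xs i) (lookup xs j)
AllPairs-lookup _ (_ ∷ _) {zero}  {zero}  i≢j = contradiction refl i≢j
AllPairs-lookup _ (r ∷ _) {zero}  {suc j} _   = All.lookup r (∈-lookup j)
AllPairs-lookup s (r ∷ _) {suc i} {zero}  _   = s (All.lookup r (∈-lookup i))
AllPairs-lookup s (_ ∷ rs) {suc i} {suc j} i≢j = AllPairs-lookup s rs (i≢j ∘ cong suc)

length-cartesianProduct : ∀ {A B : Set} (xs : List A) (ys : List B) →
  length (cartesianProduct xs ys) ≡ length xs * length ys
length-cartesianProduct []       ys = refl
length-cartesianProduct (x ∷ xs) ys = trans (length-++ (map (x ,_) ys))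
  (cong₂ _+_ (length-map (x ,_) ys) (length-cartesianProduct xs ys))

AllPairs-∈ : ∀ {A : Set} {R : Rel A 0ℓ} → Symmetric R → ∀ {xs} → AllPairs R xs →
  ∀ {x y} → x ∈ xs → y ∈ xs → x ≢ y → R x y
AllPairs-∈ _ (_ ∷ _)  (here refl) (here refl) x≢y = contradiction refl x≢y
AllPairs-∈ _ (r ∷ _)  (here refl) (there y∈)  _   = All.lookup r y∈
AllPairs-∈ s (r ∷ _)  (there x∈)  (here refl) _   = s (All.lookup r x∈)
AllPairs-∈ s (_ ∷ rs) (there x∈)  (there y∈)  x≢y = AllPairs-∈ s rs x∈ y∈ x≢y

module Ramsey {A : Set} {R : Rel A 0ℓ} (R? : Decidable₂ R) {Q : Rel A 0ℓ} where

  -- The recursion for the Ramsey threshold s w^s: the thresholds for the neighbours and for the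
  -- non-neighbours of a vertex together stay below that of the whole list.
  bound-step : ∀ s w → suc s * w ^ suc s + s * suc w ^ s < suc s * suc w ^ suc s
  bound-step s w = begin-strict
    suc s * w ^ suc s + s * suc w ^ s       <⟨ +-monoʳ-< (suc s * w ^ suc s) (m<n+m (s * suc w ^ s) (m^n>0 (suc w) s)) ⟩
    suc s * w ^ suc s + suc s * suc w ^ s   ≡⟨ *-distribˡ-+ (suc s) (w ^ suc s) (suc w ^ s) ⟨
    suc s * (w ^ suc s + suc w ^ s)         ≤⟨ *-monoʳ-≤ (suc s) (+-monoˡ-≤ (suc w ^ s) (*-monoʳ-≤ w (^-monoˡ-≤ s (n≤1+n w)))) ⟩
    suc s * (w * suc w ^ s + suc w ^ s)     ≡⟨ cong (suc s *_) (+-comm _ (suc w ^ s)) ⟩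
    suc s * suc w ^ suc s                   ∎
    where open ≤-Reasoning

  -- `Q` is inherited from the given list; taken as `_≢_` it records that the entries are distinct.
  Homogeneous : (A → Set) → Rel A 0ℓ → ℕ → Set
  Homogeneous P R k = ∃ λ ys → All P ys × AllPairs (λ x y → R x y × Q x y) ys × length ys ≡ k

  -- The tail is split into the entries related to `x` and the others, and one part exceeds its
  -- threshold. Strengthening `P` by the relation to `x` allows `x` to be put in front of the list
  -- found in that part.
  ramsey : ∀ s w {P : A → Set} xs → All P xs → AllPairs Q xs → s * w ^ s < length xs →
    Homogeneous P R (suc w) ⊎ Homogeneous P (λ x y → ¬ R x y) (suc s)
  ramsey zero    w       (x ∷ xs) (p ∷ _) _ _ = inj₂ (x ∷ [] , p ∷ [] , [] ∷ [] , refl)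
  ramsey (suc s) zero    (x ∷ xs) (p ∷ _) _ _ = inj₁ (x ∷ [] , p ∷ [] , [] ∷ [] , refl)
  ramsey (suc s) (suc w) {P} (x ∷ xs) (p ∷ ps) (q ∷ qs) lt
    with suc s * w ^ suc s <? length (filter (R? x) xs)
  ... | yes lt₁
    with ramsey (suc s) w {λ y → P y × R x y × Q x y} (filter (R? x) xs)
           (All.zip (All-filter⁺ (R? x) ps , All.zip (all-filter (R? x) xs , All-filter⁺ (R? x) q)))
           (AllPairs-filter⁺ (R? x) qs) lt₁
  ...   | inj₁ (ys , pys , rys , eq) = inj₁ (x ∷ ys , p ∷ All.map proj₁ pys , All.map proj₂ pys ∷ rys , cong suc eq)
  ...   | inj₂ (ys , pys , rys , eq) = inj₂ (ys , All.map proj₁ pys , rys , eq)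
  ramsey (suc s) (suc w) {P} (x ∷ xs) (p ∷ ps) (q ∷ qs) lt | no ≮₁
    with ramsey s (suc w) {λ y → P y × ¬ R x y × Q x y} (filter (∁? (R? x)) xs)
           (All.zip (All-filter⁺ (∁? (R? x)) ps , All.zip (all-filter (∁? (R? x)) xs , All-filter⁺ (∁? (R? x)) q)))
           (AllPairs-filter⁺ (∁? (R? x)) qs) lt₂
    where
    -- If this part were within its threshold too, `bound-step` would contradict `lt`.
    lt₂ : s * suc w ^ s < length (filter (∁? (R? x)) xs)
    lt₂ = ≰⇒> λ le → <-irrefl refl (begin-strict
      suc s * suc w ^ suc s                   ≤⟨ s≤s⁻¹ lt ⟩
      length xs                               ≡⟨ length-filter-∁ (R? x) xs ⟨
      length (filter (R? x) xs) + length (filter (∁? (R? x)) xs) ≤⟨ +-mono-≤ (≮⇒≥ ≮₁) le ⟩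
      suc s * w ^ suc s + s * suc w ^ s       <⟨ bound-step s w ⟩
      suc s * suc w ^ suc s                   ∎)
      where open ≤-Reasoning
  ... | inj₁ (ys , pys , rys , eq) = inj₁ (ys , All.map proj₁ pys , rys , eq)
  ... | inj₂ (ys , pys , rys , eq) = inj₂ (x ∷ ys , p ∷ All.map proj₁ pys , All.map proj₂ pys ∷ rys , cong suc eq)

-- Induced matchings and Wagon's bound

module Matchings {n : ℕ} (G : Graph n) where
  open Graph G

  _≁_ : Rel (Fin n) 0ℓ
  u ≁ v = ¬ (u ~ v)

  ≁-sym : Symmetric _≁_
  ≁-sym u≁v v~u = u≁v (~-sym v~u)

  Edge : Fin n × Fin n → Set
  Edge (a , b) = a ~ b

  Separated : Rel (Fin n × Fin n) 0ℓ
  Separated (a , b) (c , d) = a ≁ c × a ≁ d × b ≁ c × b ≁ d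

  Matching : List (Fin n × Fin n) → Set
  Matching M = All Edge M × AllPairs Separated M

  Separated-sym : Symmetric Separated
  Separated-sym (ac , ad , bc , bd) = ≁-sym ac , ≁-sym bc , ≁-sym ad , ≁-sym bd

  -- Distinctness of the endpoints follows from `Separated`: an endpoint common to two edges would
  -- be adjacent to the other end of each.
  inducedMatching : ∀ M → Matching M → InducedMatching G (length M)
  inducedMatching M (es , ss) = record
    { a = a ; b = b ; distinct = λ {x} {y} → distinct x y
    ; edges = λ x y → mk⇔ (to x y) (from x y) }
    where
    a b : Fin (length M) → Fin n
    a = proj₁ ∘ lookup M
    b = proj₂ ∘ lookup M
    edge : ∀ i → a i ~ b i
    edge i = All.lookup es (∈-lookup i)
    sep : ∀ {i j} → i ≢ j → Separated (lookup M i) (lookup M j)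
    sep = AllPairs-lookup Separated-sym ss
    vertex = [ a , b ]
    to : ∀ x y → vertex x ~ vertex y →
      ∃ λ i → (vertex x ≡ a i × vertex y ≡ b i) ⊎ (vertex x ≡ b i × vertex y ≡ a i)
    to (inj₁ i) (inj₁ j) e with i Fin.≟ j
    ... | yes refl = contradiction e (~-irrefl refl)
    ... | no  i≢j  = contradiction e (proj₁ (sep i≢j))
    to (inj₁ i) (inj₂ j) e with i Fin.≟ j
    ... | yes refl = i , inj₁ (refl , refl)
    ... | no  i≢j  = contradiction e (proj₁ (proj₂ (sep i≢j)))
    to (inj₂ i) (inj₁ j) e with i Fin.≟ j
    ... | yes refl = i , inj₂ (refl , refl)
    ... | no  i≢j  = contradiction e (proj₁ (proj₂ (proj₂ (sep i≢j))))
    to (inj₂ i) (inj₂ j) e with i Fin.≟ j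
    ... | yes refl = contradiction e (~-irrefl refl)
    ... | no  i≢j  = contradiction e (proj₂ (proj₂ (proj₂ (sep i≢j))))
    from : ∀ x y → (∃ λ i → (vertex x ≡ a i × vertex y ≡ b i) ⊎ (vertex x ≡ b i × vertex y ≡ a i)) →
      vertex x ~ vertex y
    from x y (i , inj₁ (p , q)) = subst₂ _~_ (sym p) (sym q) (edge i)
    from x y (i , inj₂ (p , q)) = subst₂ _~_ (sym p) (sym q) (~-sym (edge i))
    distinct : ∀ x y → vertex x ≡ vertex y → x ≡ y
    distinct (inj₁ i) (inj₁ j) eq with i Fin.≟ j
    ... | yes refl = refl
    ... | no  i≢j  = contradiction (subst (b i ~_) eq (~-sym (edge i))) (proj₁ (proj₂ (proj₂ (sep i≢j))))
    distinct (inj₂ i) (inj₂ j) eq with i Fin.≟ j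
    ... | yes refl = refl
    ... | no  i≢j  = contradiction (subst (a i ~_) eq (edge i)) (proj₁ (proj₂ (sep i≢j)))
    distinct (inj₁ i) (inj₂ j) eq with i Fin.≟ j
    ... | yes refl = contradiction (edge i) (~-irrefl eq)
    ... | no  i≢j  = contradiction (subst (b i ~_) eq (~-sym (edge i))) (proj₂ (proj₂ (proj₂ (sep i≢j))))
    distinct (inj₂ i) (inj₁ j) eq with i Fin.≟ j
    ... | yes refl = contradiction (~-sym (edge i)) (~-irrefl eq)
    ... | no  i≢j  = contradiction (subst (a i ~_) eq (edge i)) (proj₁ (sep i≢j))

  module Wagon {ω : ℕ} (clique≤ : ∀ xs → AllPairs _~_ xs → length xs ≤ ω)
                   {a : ℕ} (independent≤ : ∀ xs → Unique xs → (∀ {u v} → u ∈ xs → v ∈ xs → u ≁ v) → length xs ≤ a) where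

    Within : List (Fin n) → Fin n × Fin n → Set
    Within U (x , y) = x ∈ U × y ∈ U

    -- Stated relative to `U`, so that the induction can pass to classes of vertices.
    NoMatching : ℕ → List (Fin n) → Set
    NoMatching t U = ∀ M → Matching M → All (Within U) M → length M ≢ t

    CliqueOfSize : List (Fin n) → ℕ → Set
    CliqueOfSize U k = ∃ λ K → AllPairs _~_ K × All (_∈ U) K × length K ≡ k

    -- If no clique in `U` were maximum, cliques would grow beyond `ω`. The double negation avoids
    -- deciding whether a larger clique exists.
    maximumClique : ∀ U → ¬ ¬ ∃ λ k → CliqueOfSize U k × ¬ CliqueOfSize U (suc k)
    maximumClique U none = grow (suc ω) λ (K , cl , _ , eq) → <⇒≱ (≤-reflexive (sym eq)) (clique≤ K cl)
      where
      grow : ∀ k → ¬ ¬ CliqueOfSize U k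
      grow zero    ¬c = ¬c ([] , [] , [] , refl)
      grow (suc k) ¬c = grow k λ c → none (k , c , ¬c)

    module Classes (U : List (Fin n)) (K : List (Fin n)) (clique : AllPairs _~_ K) (K⊆U : All (_∈ U) K)
                   (maximum : ¬ CliqueOfSize U (suc (length K))) where

      -- The class of (u , u) is independent because K is maximum; to an induced matching in the
      -- class of (u , u′) with u ≠ u′ the edge uu′ can be added.
      Class : Fin n × Fin n → Fin n → Set
      Class (u , u′) v = v ≁ u × v ≁ u′ × (u ≡ u′ → All (λ z → z ≢ u → v ~ z) K)

      class? : ∀ c → Decidable (Class c)
      class? (u , u′) v = ¬? (v ~? u) ×-dec (¬? (v ~? u′) ×-dec
        ((u Fin.≟ u′) →-dec all? (λ z → ¬? (z Fin.≟ u) →-dec (v ~? z)) K))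

      -- Since `K` is maximum, `v` has a non-neighbour `u` in it. If `u` is the only one, the class
      -- of (u , u) applies, otherwise that of `u` and a second non-neighbour.
      covered : ∀ {v} → v ∈ U → Any (λ c → Class c v) (cartesianProduct K K)
      covered {v} v∈U with all? (v ~?_) K
      ... | yes v~K = contradiction (v ∷ K , v~K ∷ clique , v∈U ∷ K⊆U , refl) maximum
      ... | no ¬v~K with find (¬All⇒Any¬ (v ~?_) K ¬v~K)
      ...   | u , u∈K , v≁u with all? (λ z → ¬? (z Fin.≟ u) →-dec (v ~? z)) K
      ...     | yes only = lose (∈-cartesianProduct⁺ u∈K u∈K) (v≁u , v≁u , λ _ → only)
      ...     | no ¬only with find (¬All⇒Any¬ (λ z → ¬? (z Fin.≟ u) →-dec (v ~? z)) K ¬only)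
      ...       | u′ , u′∈K , ¬v~u′ = lose (∈-cartesianProduct⁺ u∈K u′∈K)
                    (v≁u , (λ e → ¬v~u′ λ _ → e) , λ { refl → contradiction (λ ne → contradiction refl ne) ¬v~u′ })

      class : Fin n × Fin n → List (Fin n)
      class c = filter (class? c) U

      ∈-class⁻ : ∀ {c v} → v ∈ class c → v ∈ U × Class c v
      ∈-class⁻ {c} = ∈-filter⁻ (class? c) {xs = U}

      -- Replacing `u` in `K` by two adjacent members of its class would give a larger clique in
      -- `U`. To this end `K` is permuted so that `u` comes first.
      diagonal-independent : ∀ {u} → u ∈ K → ∀ {x y} → x ∈ class (u , u) → y ∈ class (u , u) → x ≁ y
      diagonal-independent {u} u∈K {x} {y} x∈ y∈ x~y
        with ∈-class⁻ {u , u} x∈ | ∈-class⁻ {u , u} y∈ | ∈-∃++ u∈K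
      ... | x∈U , x≁u , _ , x~ | y∈U , y≁u , _ , y~ | ks , ls , refl
        with AllPairs-resp-↭ (setoid (Fin n)) ~-sym (respʳ _~_ , respˡ _~_) (↭⇒↭ₛ (shift u ks ls)) clique
           | All-resp-↭ (shift u ks ls) K⊆U
      ...   | u~K′ ∷ clique′ | _ ∷ K′⊆U = maximum (x ∷ y ∷ ks ++ ls
              , (x~y ∷ near (x~ refl)) ∷ near (y~ refl) ∷ clique′ , x∈U ∷ y∈U ∷ K′⊆U
              , cong suc (sym (↭-length (shift u ks ls))))
        where
        near : ∀ {v} → All (λ z → z ≢ u → v ~ z) (ks ++ u ∷ ls) → All (v ~_) (ks ++ ls)
        near only = All.tabulate λ {z} z∈ → All.lookup only (∈-resp-↭ (↭-sym (shift u ks ls)) (there z∈))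
          λ z≡u → ~-irrefl (sym z≡u) (All.lookup u~K′ z∈)

      class-noMatching : ∀ {t c} → c ∈ cartesianProduct K K → NoMatching (suc (suc t)) U → NoMatching (suc t) (class c)
      class-noMatching {t} {u , u′} c∈ none M (es , ss) M⊆ eq =
        by-cases (u Fin.≟ u′) es ss M⊆ eq
        where
        u∈K = proj₁ (∈-cartesianProduct⁻ K K c∈)
        u′∈K = proj₂ (∈-cartesianProduct⁻ K K c∈)
        away : ∀ {e} → Within (class (u , u′)) e → Separated (u , u′) e
        away (x∈ , y∈) with ∈-class⁻ {u , u′} x∈ | ∈-class⁻ {u , u′} y∈
        ... | _ , xu , xu′ , _ | _ , yu , yu′ , _ = ≁-sym xu , ≁-sym yu , ≁-sym xu′ , ≁-sym yu′
        into : ∀ {e} → Within (class (u , u′)) e → Within U e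
        into (x∈ , y∈) = proj₁ (∈-class⁻ {u , u′} x∈) , proj₁ (∈-class⁻ {u , u′} y∈)
        by-cases : ∀ {M} → Dec (u ≡ u′) → All Edge M → AllPairs Separated M →
          All (Within (class (u , u′))) M → length M ≢ suc t
        -- The matching is nonempty, and its first edge would lie inside an independent class.
        by-cases (yes refl) (e ∷ _) _ ((x∈ , y∈) ∷ _) _ = diagonal-independent u∈K x∈ y∈ e
        by-cases (no u≢u′) es ss M⊆ eq = none _
          (AllPairs-∈ ~-sym clique u∈K u′∈K u≢u′ ∷ es , All.map away M⊆ ∷ ss)
          ((All.lookup K⊆U u∈K , All.lookup K⊆U u′∈K) ∷ All.map into M⊆) (cong suc eq)

    -- For s = 0 there is no edge inside `U`. In the step, `U` is covered by at most ω² classes,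
    -- each of which excludes a matching smaller by one edge.
    length-bound : ∀ s U → Unique U → NoMatching (suc s) U → length U ≤ (ω * ω) ^ s * a
    length-bound zero U uniq none = ≤-trans
      (independent≤ U uniq λ x∈U y∈U e → none (_ ∷ []) (e ∷ [] , [] ∷ []) ((x∈U , y∈U) ∷ []) refl)
      (≤-reflexive (sym (*-identityˡ a)))
    -- The goal is decidable, so the doubly negated maximum clique can be used.
    length-bound (suc s) U uniq none = decidable-stable (length U ≤? _) λ ≰ → maximumClique U
      λ { (_ , (K , clique , K⊆U , refl) , maximum) → ≰ (bound K clique K⊆U maximum) }
      where
      open ≤-Reasoning
      bound : ∀ K → AllPairs _~_ K → All (_∈ U) K → ¬ CliqueOfSize U (suc (length K)) →
        length U ≤ (ω * ω) ^ suc s * a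
      bound K clique K⊆U maximum = begin
        length U                                              ≤⟨ length-cover class? (cartesianProduct K K) U (All.tabulate covered)
          (All.tabulate λ {c} c∈ → length-bound s (class c) (AllPairs-filter⁺ (class? c) uniq) (class-noMatching c∈ none)) ⟩
        length (cartesianProduct K K) * ((ω * ω) ^ s * a)     ≡⟨ cong (_* ((ω * ω) ^ s * a)) (length-cartesianProduct K K) ⟩
        length K * length K * ((ω * ω) ^ s * a)               ≤⟨ *-monoˡ-≤ _ (*-mono-≤ (clique≤ K clique) (clique≤ K clique)) ⟩
        ω * ω * ((ω * ω) ^ s * a)                             ≡⟨ *-assoc (ω * ω) _ a ⟨
        (ω * ω) ^ suc s * a                                   ∎
        where open Classes U K clique K⊆U maximum

-- Subsets as lists, and shattering

insert : ∀ {n} → Fin n → Subset n → Subset n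
insert x p = p [ x ]≔ inside

∣insert∣ : ∀ {n} {x : Fin n} {p} → x ∉ₛ p → ∣ insert x p ∣ ≡ suc ∣ p ∣
∣insert∣ {x = zero}  {inside  ∷ p} x∉p = contradiction here x∉p
∣insert∣ {x = zero}  {outside ∷ p} x∉p = refl
∣insert∣ {x = suc x} {inside  ∷ p} x∉p = cong suc (∣insert∣ (x∉p ∘ there))
∣insert∣ {x = suc x} {outside ∷ p} x∉p = ∣insert∣ (x∉p ∘ there)

∣insert∣≤ : ∀ {n} (x : Fin n) p → ∣ insert x p ∣ ≤ suc ∣ p ∣
∣insert∣≤ zero    (inside  ∷ p) = n≤1+n _
∣insert∣≤ zero    (outside ∷ p) = ≤-refl
∣insert∣≤ (suc x) (inside  ∷ p) = s≤s (∣insert∣≤ x p)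
∣insert∣≤ (suc x) (outside ∷ p) = ∣insert∣≤ x p

∈-insert⁻ : ∀ {n} {x y : Fin n} {p} → y ∈ₛ insert x p → y ≡ x ⊎ y ∈ₛ p
∈-insert⁻ {x = zero}  {p = _ ∷ _} here      = inj₁ refl
∈-insert⁻ {x = zero}  {p = _ ∷ _} (there q) = inj₂ (there q)
∈-insert⁻ {x = suc x} {p = _ ∷ _} here      = inj₂ here
∈-insert⁻ {x = suc x} {p = _ ∷ _} (there q) = Sum.map (cong suc) there (∈-insert⁻ q)

∈-insert : ∀ {n} (x : Fin n) p → x ∈ₛ insert x p
∈-insert zero    (_ ∷ _) = here
∈-insert (suc x) (_ ∷ p) = there (∈-insert x p)

⊆-insert : ∀ {n} {x y : Fin n} {p} → y ∈ₛ p → y ∈ₛ insert x p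
⊆-insert {x = zero}  here      = here
⊆-insert {x = suc x} here      = here
⊆-insert {x = zero}  (there q) = there q
⊆-insert {x = suc x} (there q) = there (⊆-insert q)

fromList : ∀ {n} → List (Fin n) → Subset n
fromList []       = ∅
fromList (x ∷ xs) = insert x (fromList xs)

∈-fromList⁻ : ∀ {n} {y : Fin n} xs → y ∈ₛ fromList xs → y ∈ xs
∈-fromList⁻ []       y∈ = contradiction y∈ ∉⊥
∈-fromList⁻ (x ∷ xs) y∈ = [ here , there ∘ ∈-fromList⁻ xs ] (∈-insert⁻ y∈)

∈-fromList⁺ : ∀ {n} {y : Fin n} {xs} → y ∈ xs → y ∈ₛ fromList xs
∈-fromList⁺ {xs = x ∷ xs} (here refl) = ∈-insert x (fromList xs)
∈-fromList⁺ (there y∈)  = ⊆-insert (∈-fromList⁺ y∈)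

∣fromList∣≤ : ∀ {n} (xs : List (Fin n)) → ∣ fromList xs ∣ ≤ length xs
∣fromList∣≤ {n} []   = ≤-reflexive (∣⊥∣≡0 n)
∣fromList∣≤ (x ∷ xs) = ≤-trans (∣insert∣≤ x (fromList xs)) (s≤s (∣fromList∣≤ xs))

∣fromList∣ : ∀ {n} {xs : List (Fin n)} → Unique xs → ∣ fromList xs ∣ ≡ length xs
∣fromList∣ {n} []            = ∣⊥∣≡0 n
∣fromList∣ {xs = x ∷ xs} (x∉ ∷ u) = trans
  (∣insert∣ λ x∈ → All.lookup x∉ (∈-fromList⁻ xs x∈) refl) (cong suc (∣fromList∣ u))

elements : ∀ {n} → Subset n → List (Fin n)
elements []            = []
elements (inside  ∷ p) = zero ∷ map suc (elements p)
elements (outside ∷ p) = map suc (elements p)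

length-elements : ∀ {n} (p : Subset n) → length (elements p) ≡ ∣ p ∣
length-elements []            = refl
length-elements (inside  ∷ p) = cong suc (trans (length-map suc (elements p)) (length-elements p))
length-elements (outside ∷ p) = trans (length-map suc (elements p)) (length-elements p)

elements-∈ : ∀ {n} (p : Subset n) → All (_∈ₛ p) (elements p)
elements-∈ []            = []
elements-∈ (inside  ∷ p) = here ∷ All-map⁺ (All.map there (elements-∈ p))
elements-∈ (outside ∷ p) = All-map⁺ (All.map there (elements-∈ p))

elements-unique : ∀ {n} (p : Subset n) → Unique (elements p)
elements-unique []            = []
elements-unique (inside  ∷ p) = All-map⁺ (All.universal (λ _ ()) (elements p))
  ∷ AllPairs-map⁺ (AllPairs.map (_∘ Fin.suc-injective) (elements-unique p))
elements-unique (outside ∷ p) = AllPairs-map⁺ (AllPairs.map (_∘ Fin.suc-injective) (elements-unique p))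

AllPairs-zip-All : ∀ {A : Set} {P : A → Set} {R : Rel A 0ℓ} {xs} → All P xs → AllPairs R xs →
  AllPairs (λ x y → P x × P y × R x y) xs
AllPairs-zip-All []       []       = []
AllPairs-zip-All (p ∷ ps) (r ∷ rs) = All.map (p ,_) (All.zip (ps , r)) ∷ AllPairs-zip-All ps rs

-- A family of sets is a predicate on characteristic vectors. The pattern to be realised is a full
-- vector `T`, of which only the coordinates in `S` matter.
Shatters : ∀ {N} → (Vec Bool N → Set) → Subset N → Set
Shatters P S = ∀ T → ∃ λ T′ → P T′ × (∀ i → i ∈ₛ S → Vec.lookup T′ i ≡ Vec.lookup T i)

-- Samples are vectors and may repeat vertices, so a trace is indexed by sample positions.
trace : ∀ {n N} → Subset n → Vec (Fin n) N → Vec Bool N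
trace I W = Vec.map (Vec.lookup I) W

-- Sets shattered by maximum independent sets

module VC {n : ℕ} (G : Graph n) where
  open Graph G
  open Matchings G

  -- Equivalent to `IsMaximumIndependent`: the independent set attaining the size of `I` is `I`
  -- itself.
  Maximum : Subset n → Set
  Maximum I = IsIndependent G I × (∀ J → IsIndependent G J → ∣ J ∣ ≤ ∣ I ∣)

  -- Otherwise inserting `w` would give a larger independent set.
  maximum-dominates : ∀ {I w} → Maximum I → w ∉ₛ I → ∃ λ y → y ∈ₛ I × y ~ w
  maximum-dominates {I} {w} (ind , max) w∉I with Fin.any? (λ y → (y ∈? I) ×-dec (y ~? w))
  ... | yes found = found
  ... | no ¬found = contradiction (max (insert w I) ind′) (<⇒≱ (≤-reflexive (sym (∣insert∣ w∉I))))
    where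
    ind′ : IsIndependent G (insert w I)
    ind′ u v u∈ v∈ u~v with ∈-insert⁻ u∈ | ∈-insert⁻ v∈
    ... | inj₁ refl | inj₁ refl = ~-irrefl refl u~v
    ... | inj₁ refl | inj₂ v∈I  = ¬found (v , v∈I , ~-sym u~v)
    ... | inj₂ u∈I  | inj₁ refl = ¬found (u , u∈I , u~v)
    ... | inj₂ u∈I  | inj₂ v∈I  = ind u v u∈I v∈I u~v

  IsTrace : ∀ {N} → Vec (Fin n) N → Vec Bool N → Set
  IsTrace W T = ∃ λ I → Maximum I × trace I W ≡ T

  module _ {ω s : ℕ} (clique≤ : ∀ xs → AllPairs _~_ xs → length xs ≤ ω)
           (noMatching : ∀ M → Matching M → length M ≢ suc s) where

    -- Ramsey's theorem is applied to the positions in `S`, two of them being related when their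
    -- private neighbours are adjacent.
    shattered-size : ∀ {N} (W : Vec (Fin n) N) {S} → Shatters (IsTrace W) S → ∣ S ∣ ≤ s * ω ^ s
    shattered-size {N} W {S} shattered = ≮⇒≥ λ lt → absurd
      (Ramsey.ramsey (λ i j → y i ~? y j) s ω (elements S) (elements-∈ S) (elements-unique S)
        (subst (s * ω ^ s <_) (sym (length-elements S)) lt))
      where
      w : Fin N → Fin n
      w = Vec.lookup W

      lookup-trace : ∀ I i {b} → Vec.lookup (trace I W) i ≡ b → Vec.lookup I (w i) ≡ b
      lookup-trace I i eq = trans (sym (Vec.lookup-map i (Vec.lookup I) W)) eq

      independent : ∀ {i j} → i ∈ₛ S → j ∈ₛ S → w i ≁ w j
      -- The pattern `S` itself yields a maximum independent set containing every `w i` with i in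
      -- `S`.
      independent {i} {j} i∈S j∈S with shattered S
      ... | _ , (I , (ind , _) , refl) , agree = ind (w i) (w j) (member i∈S) (member j∈S)
        where
        member : ∀ {k} → k ∈ₛ S → w k ∈ₛ I
        member {k} k∈S = Vec.lookup⇒[]= (w k) I
          (lookup-trace I k (trans (agree k k∈S) (Vec.[]=⇒lookup k∈S)))

      private-neighbour : ∀ i → ∃ λ y → i ∈ₛ S → w i ~ y × (∀ {j} → j ∈ₛ S → i ≢ j → y ≁ w j)
      private-neighbour i with i ∈? S
      ... | no i∉S = w i , λ i∈S → contradiction i∈S i∉S
      -- The pattern that omits only `i`: the set realising it misses `w i`, so it contains a
      -- neighbour of `w i`, and this is not adjacent to the other `w j`, which lie in the same set.
      ... | yes i∈S with shattered (S [ i ]≔ outside)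
      ...   | _ , (I , max@(ind , _) , refl) , agree with maximum-dominates max wi∉I
        where
        wi∉I : w i ∉ₛ I
        wi∉I wi∈I with trans (sym (Vec.[]=⇒lookup wi∈I))
          (lookup-trace I i (trans (agree i i∈S) (Vec.lookup∘update i S outside)))
        ... | ()
      ...     | y , y∈I , y~wi = y , λ _ → ~-sym y~wi , λ {j} j∈S i≢j → ind y (w j) y∈I (Vec.lookup⇒[]= (w j) I
                (lookup-trace I j (trans (agree j j∈S)
                  (trans (Vec.lookup∘update′ (i≢j ∘ sym) S outside) (Vec.[]=⇒lookup j∈S)))))

      y : Fin N → Fin n
      y = proj₁ ∘ private-neighbour

      Homogeneous : Rel (Fin N) 0ℓ → ℕ → Set
      Homogeneous = Ramsey.Homogeneous (λ i j → y i ~? y j) {_≢_} (_∈ₛ S)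

      -- Adjacent private neighbours form too large a clique. Pairwise non-adjacent ones give, with
      -- the independent `w i`, an induced matching of size s + 1.
      absurd : ¬ (Homogeneous (λ i j → y i ~ y j) (suc ω) ⊎ Homogeneous (λ i j → y i ≁ y j) (suc s))
      absurd (inj₁ (is , _ , rs , eq)) = <⇒≱ (≤-reflexive (sym (trans (length-map y is) eq)))
        (clique≤ (map y is) (AllPairs-map⁺ (AllPairs.map proj₁ rs)))
      absurd (inj₂ (is , is∈S , rs , eq)) = noMatching (map (λ i → w i , y i) is)
        ( All-map⁺ (All.map (λ {i} i∈S → proj₁ (proj₂ (private-neighbour i) i∈S)) is∈S)
        , AllPairs-map⁺ (AllPairs.map separated (AllPairs-zip-All is∈S rs)))
        (trans (length-map _ is) eq)
        where
        separated : ∀ {i j} → i ∈ₛ S × j ∈ₛ S × y i ≁ y j × i ≢ j → Separated (w i , y i) (w j , y j)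
        separated {i} {j} (i∈S , j∈S , yy , i≢j) = independent i∈S j∈S
          , ≁-sym (proj₂ (proj₂ (private-neighbour j) j∈S) i∈S (i≢j ∘ sym))
          , proj₂ (proj₂ (private-neighbour i) i∈S) j∈S i≢j , yy

-- Sums over finite enumerations

private variable A B : Set

total : List A → (A → ℕ) → ℕ
total xs f = sum (map f xs)

total-cong : ∀ (xs : List A) {f g} → (∀ x → f x ≡ g x) → total xs f ≡ total xs g
total-cong []       eq = refl
total-cong (x ∷ xs) eq = cong₂ _+_ (eq x) (total-cong xs eq)

total-mono-≤ : ∀ (xs : List A) {f g} → (∀ x → f x ≤ g x) → total xs f ≤ total xs g
total-mono-≤ []       le = z≤n
total-mono-≤ (x ∷ xs) le = +-mono-≤ (le x) (total-mono-≤ xs le)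

total-+ : ∀ (xs : List A) f g → total xs (λ x → f x + g x) ≡ total xs f + total xs g
total-+ []       f g = refl
total-+ (x ∷ xs) f g rewrite total-+ xs f g =
  solve 4 (λ a b c d → a :+ b :+ (c :+ d) := a :+ c :+ (b :+ d)) refl (f x) (g x) (total xs f) (total xs g)
  where open +-*-Solver

total-const : ∀ (xs : List A) c → total xs (λ _ → c) ≡ length xs * c
total-const []       c = refl
total-const (x ∷ xs) c = cong (c +_) (total-const xs c)

total-*ʳ : ∀ (xs : List A) f c → total xs (λ x → f x * c) ≡ total xs f * c
total-*ʳ []       f c = refl
total-*ʳ (x ∷ xs) f c = trans (cong (f x * c +_) (total-*ʳ xs f c)) (sym (*-distribʳ-+ c (f x) _))

total-swap : ∀ (xs : List A) (ys : List B) (f : A → B → ℕ) →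
  total xs (λ x → total ys (f x)) ≡ total ys (λ y → total xs (λ x → f x y))
total-swap []       ys f = sym (trans (total-const ys 0) (*-zeroʳ (length ys)))
total-swap (x ∷ xs) ys f = trans (cong (total ys (f x) +_) (total-swap xs ys f))
  (sym (total-+ ys (f x) (λ y → total xs (λ x → f x y))))

∈⇒≤total : ∀ {xs : List A} f {x} → x ∈ xs → f x ≤ total xs f
∈⇒≤total f (here refl) = m≤m+n _ _
∈⇒≤total f (there x∈)  = m≤n⇒m≤o+n _ (∈⇒≤total f x∈)

total-product : ∀ {C : Set} (_∙_ : A → B → C) (xs : List A) (ys : List B) f →
  total (cartesianProductWith _∙_ xs ys) f ≡ total xs (λ x → total ys (λ y → f (x ∙ y)))
total-product _∙_ []       ys f = refl
total-product _∙_ (x ∷ xs) ys f = begin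
  sum (map f (map (x ∙_) ys ++ rest))          ≡⟨ cong sum (map-++ f (map (x ∙_) ys) rest) ⟩
  sum (map f (map (x ∙_) ys) ++ map f rest)    ≡⟨ sum-++ (map f (map (x ∙_) ys)) (map f rest) ⟩
  sum (map f (map (x ∙_) ys)) + total rest f   ≡⟨ cong₂ _+_ (cong sum (sym (map-∘ ys))) (total-product _∙_ xs ys f) ⟩
  total ys (λ y → f (x ∙ y)) + total xs (λ x → total ys (λ y → f (x ∙ y))) ∎
  where
  open ≡-Reasoning
  rest = cartesianProductWith _∙_ xs ys

-- The sample space. Averages over samples appear below as totals over `vecs`, with the denominators
-- cleared.
vecs : List A → ∀ m → List (Vec A m)
vecs xs zero    = [] ∷ []
vecs xs (suc m) = cartesianProductWith _∷_ xs (vecs xs m)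

total-vecs : ∀ (xs : List A) m f →
  total (vecs xs (suc m)) f ≡ total xs (λ x → total (vecs xs m) (λ v → f (x ∷ v)))
total-vecs xs m = total-product _∷_ xs (vecs xs m)

total-vecs² : ∀ (xs : List A) m f →
  total (vecs xs (suc (suc m))) f ≡ total xs (λ x → total xs (λ y → total (vecs xs m) (λ v → f (x ∷ y ∷ v))))
total-vecs² xs m f = trans (total-vecs xs (suc m) f) (total-cong xs λ x → total-vecs xs m _)

∈-vecs : ∀ {xs : List A} → (∀ x → x ∈ xs) → ∀ {m} (v : Vec A m) → v ∈ vecs xs m
∈-vecs all []      = here refl
∈-vecs all (x ∷ v) = ∈-cartesianProductWith⁺ _∷_ (all x) (∈-vecs all v)

length-vecs : ∀ (xs : List A) m → length (vecs xs m) ≡ length xs ^ m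
length-vecs xs m = trans (sym (trans (total-const (vecs xs m) 1) (*-identityʳ _))) (count m)
  where
  count : ∀ m → total (vecs xs m) (λ _ → 1) ≡ length xs ^ m
  count zero    = refl
  count (suc m) = trans (total-vecs xs m _) (trans (total-cong xs λ _ → count m) (total-const xs _))

bools : List Bool
bools = false ∷ true ∷ []

∈-bools : ∀ b → b ∈ bools
∈-bools false = here refl
∈-bools true  = there (here refl)

-- Sauer–Shelah

indicator : ∀ {P : Set} → Dec P → ℕ
indicator P? = if does P? then 1 else 0

count : ∀ {N} {P : Vec Bool N → Set} → Decidable P → ℕ
count {N} P? = total (vecs bools N) (λ T → indicator (P? T))

indicator-⊎-× : ∀ {P Q : Set} (P? : Dec P) (Q? : Dec Q) →
  indicator P? + indicator Q? ≡ indicator (P? ⊎-dec Q?) + indicator (P? ×-dec Q?)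
indicator-⊎-× (yes _) (yes _) = refl
indicator-⊎-× (yes _) (no  _) = refl
indicator-⊎-× (no  _) (yes _) = refl
indicator-⊎-× (no  _) (no  _) = refl

-- Here the second argument is the least size excluded from shattering, hence the shift by one:
-- excluding size d + 1 leaves at most the sum of the binomials (N choose i) for i ≤ d, which is at
-- most (N + 1)^d.
sauerBound : ℕ → ℕ → ℕ
sauerBound N zero    = 0
sauerBound N (suc d) = suc N ^ d

sauerBound-step : ∀ N d → sauerBound N (suc d) + sauerBound N d ≤ sauerBound (suc N) (suc d)
sauerBound-step N zero    = ≤-refl
sauerBound-step N (suc d) = begin
  suc N * suc N ^ d + suc N ^ d    ≡⟨ +-comm _ (suc N ^ d) ⟩
  suc (suc N) * suc N ^ d          ≤⟨ *-monoʳ-≤ (suc (suc N)) (^-monoˡ-≤ d (n≤1+n (suc N))) ⟩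
  suc (suc N) * suc (suc N) ^ d    ∎
  where open ≤-Reasoning

-- With P₀ and P₁ the sections of P by the first coordinate, |P| = |P₀ ∪ P₁| + |P₀ ∩ P₁|;
-- a set shattered by P₀ ∩ P₁ stays shattered by P after the first coordinate is added to it.
sauer : ∀ d {N} {P : Vec Bool N → Set} (P? : Decidable P) →
  (∀ S → ∣ S ∣ ≡ d → ¬ Shatters P S) → count P? ≤ sauerBound N d
sauer zero {N} P? none = ≤-trans
  (total-mono-≤ (vecs bools N) λ T → empty T (P? T))
  (≤-reflexive (trans (total-const (vecs bools N) 0) (*-zeroʳ (length (vecs bools N)))))
  where
  empty : ∀ T P?T → indicator P?T ≤ 0
  empty T (no  _) = z≤n
  -- A single member of the family already shatters the empty set.
  empty T (yes p) = contradiction (λ _ → T , p , λ _ i∈∅ → contradiction i∈∅ ∉⊥) (none ∅ (∣⊥∣≡0 N))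
sauer (suc d) {zero} P? none with does (P? [])
... | true  = ≤-reflexive (sym (^-zeroˡ d))
... | false = z≤n
sauer (suc d) {suc N} {P} P? none = begin
  count P?                                        ≡⟨ total-vecs bools N _ ⟩
  count P₀? + (count P₁? + 0)                     ≡⟨ cong (count P₀? +_) (+-identityʳ _) ⟩
  count P₀? + count P₁?                           ≡⟨ total-+ (vecs bools N) _ _ ⟨
  total (vecs bools N) (λ T → indicator (P₀? T) + indicator (P₁? T))
                                                  ≡⟨ total-cong (vecs bools N) (λ T → indicator-⊎-× (P₀? T) (P₁? T)) ⟩
  total (vecs bools N) (λ T → indicator (P∪? T) + indicator (P∩? T))
                                                  ≡⟨ total-+ (vecs bools N) _ _ ⟩
  count P∪? + count P∩?                           ≤⟨ +-mono-≤ (sauer (suc d) P∪? none∪) (sauer d P∩? none∩) ⟩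
  sauerBound N (suc d) + sauerBound N d           ≤⟨ sauerBound-step N d ⟩
  sauerBound (suc N) (suc d)                      ∎
  where
  open ≤-Reasoning
  P₀? = λ T → P? (false ∷ T)
  P₁? = λ T → P? (true ∷ T)
  P∪? = λ T → P₀? T ⊎-dec P₁? T
  P∩? = λ T → P₀? T ×-dec P₁? T
  none∪ : ∀ S → ∣ S ∣ ≡ suc d → ¬ Shatters (λ T → P (false ∷ T) ⊎ P (true ∷ T)) S
  none∪ S eq sh = none (outside ∷ S) eq λ { (_ ∷ T) → extend (sh T) }
    where
    extend : ∀ {b T} → (∃ λ T′ → (P (false ∷ T′) ⊎ P (true ∷ T′)) × (∀ i → i ∈ₛ S → Vec.lookup T′ i ≡ Vec.lookup T i)) →
      ∃ λ T′ → P T′ × (∀ i → i ∈ₛ outside ∷ S → Vec.lookup T′ i ≡ Vec.lookup (b ∷ T) i)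
    extend (T′ , inj₁ p , agree) = false ∷ T′ , p , λ { (suc i) i∈ → agree i (drop-there i∈) }
    extend (T′ , inj₂ p , agree) = true  ∷ T′ , p , λ { (suc i) i∈ → agree i (drop-there i∈) }
  none∩ : ∀ S → ∣ S ∣ ≡ d → ¬ Shatters (λ T → P (false ∷ T) × P (true ∷ T)) S
  none∩ S eq sh = none (inside ∷ S) (cong suc eq) extend
    where
    extend : Shatters P (inside ∷ S)
    extend (false ∷ T) with sh T
    ... | T′ , (p , _) , agree = false ∷ T′ , p , λ { zero _ → refl ; (suc i) i∈ → agree i (drop-there i∈) }
    extend (true ∷ T) with sh T
    ... | T′ , (_ , p) , agree = true  ∷ T′ , p , λ { zero _ → refl ; (suc i) i∈ → agree i (drop-there i∈) }

-- Double sampling and symmetrization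

-- A vector of length m * 2 is read as m pairs; the first entries are the sample, the second
-- entries the ghost sample.

interleave : ∀ {m} → Vec A m → Vec A m → Vec A (m * 2)
interleave []      []      = []
interleave (x ∷ v) (y ∷ w) = x ∷ y ∷ interleave v w

-- Turns two independent samples into one sample of pairs, in which the two entries of a pair can be
-- exchanged.
total-interleave : ∀ (xs : List A) m f →
  total (vecs xs (m * 2)) f ≡ total (vecs xs m) (λ v → total (vecs xs m) (λ w → f (interleave v w)))
total-interleave xs zero    f = sym (+-identityʳ _)
total-interleave xs (suc m) f = begin
  total (vecs xs (suc m * 2)) f
    ≡⟨ total-vecs² xs (m * 2) f ⟩
  total xs (λ x → total xs λ y → total (vecs xs (m * 2)) λ u → f (x ∷ y ∷ u))
    ≡⟨ total-cong xs (λ x → total-cong xs λ y → total-interleave xs m _) ⟩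
  total xs (λ x → total xs λ y → total (vecs xs m) λ v → total (vecs xs m) λ w → f (x ∷ y ∷ interleave v w))
    ≡⟨ total-cong xs (λ x → total-swap xs (vecs xs m) _) ⟩
  total xs (λ x → total (vecs xs m) λ v → total xs λ y → total (vecs xs m) λ w → f (x ∷ y ∷ interleave v w))
    ≡⟨ total-cong xs (λ x → total-cong (vecs xs m) λ v → total-vecs xs m _) ⟨
  total xs (λ x → total (vecs xs m) λ v → total (vecs xs (suc m)) λ w → f (interleave (x ∷ v) w))
    ≡⟨ total-vecs xs m _ ⟨
  total (vecs xs (suc m)) (λ v → total (vecs xs (suc m)) λ w → f (interleave v w)) ∎
  where open ≡-Reasoning

-- On the trace of `I` this is 0 if the sample meets `I`, and otherwise 2 to the number of ghost
-- entries in `I`.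
weight : ∀ {m} → Vec Bool (m * 2) → ℕ
weight {zero}  []                 = 1
weight {suc m} (true  ∷ _     ∷ T) = 0
weight {suc m} (false ∷ true  ∷ T) = weight {m} T + weight {m} T
weight {suc m} (false ∷ false ∷ T) = weight {m} T

-- Exchanges the entries of one pair, at the same place in both vectors; single exchanges suffice
-- because `symmetrization` treats one pair at a time.
data Swap {A B : Set} : ∀ {m} → Vec A (m * 2) → Vec B (m * 2) → Vec A (m * 2) → Vec B (m * 2) → Set where
  here  : ∀ {m a a′ b b′ W T} → Swap {m = suc m} (a ∷ a′ ∷ W) (b ∷ b′ ∷ T) (a′ ∷ a ∷ W) (b′ ∷ b ∷ T)
  there : ∀ {m a a′ b b′ W T W′ T′} → Swap {m = m} W T W′ T′ →
          Swap {m = suc m} (a ∷ a′ ∷ W) (b ∷ b′ ∷ T) (a ∷ a′ ∷ W′) (b ∷ b′ ∷ T′)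

SwapInvariant : ∀ {m} → (Vec A (m * 2) → Vec B (m * 2) → ℕ) → Set
SwapInvariant {m = m} Q = ∀ {W T W′ T′} → Swap {m = m} W T W′ T′ → Q W T ≡ Q W′ T′

-- Averaged over the two orders of a pair, the weight of each coordinate pair is at most 1.
symmetrization : ∀ (xs : List A) m (Q : Vec A (m * 2) → Vec Bool (m * 2) → ℕ) → SwapInvariant {m = m} Q →
  total (vecs xs (m * 2)) (λ W → total (vecs bools (m * 2)) (λ T → Q W T * weight {m} T)) ≤
  total (vecs xs (m * 2)) (λ W → total (vecs bools (m * 2)) (Q W))
symmetrization xs zero    Q inv = ≤-reflexive (cong (λ z → z + 0 + 0) (*-identityʳ (Q [] [])))
symmetrization {A} xs (suc m) Q inv = begin
  total (vecs xs (suc m * 2)) (λ W → total (vecs bools (suc m * 2)) (λ T → Q W T * weight {suc m} T))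
    ≡⟨ expand (λ W T → Q W T * weight {suc m} T) ⟩
  pairs (λ a a′ → total bools λ b → total bools λ b′ → weighted a a′ b b′)
    -- Traces with `true` in the sample place have weight 0, and (false , true) counts twice.
    ≤⟨ total-mono-≤ xs (λ a → total-mono-≤ xs λ a′ → weighted≤ a a′) ⟩
  pairs (λ a a′ → R a a′ false false + R a a′ false true + R a a′ false true)
    ≡⟨ pairs-+ falses (λ a a′ → R a a′ false true) ⟩
  pairs falses + pairs (λ a a′ → R a a′ false true)
    -- By invariance under exchange, one of the two copies of (false , true) becomes (true , false);
    -- no trace is then counted more than once.
    ≡⟨ cong (pairs falses +_) (trans (total-swap xs xs _) (total-cong xs λ a → total-cong xs λ a′ → reversed a′ a)) ⟩
  pairs falses + pairs (λ a a′ → R a a′ true false)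
    ≡⟨ pairs-+ falses (λ a a′ → R a a′ true false) ⟨
  pairs (λ a a′ → R a a′ false false + R a a′ false true + R a a′ true false)
    ≤⟨ total-mono-≤ xs (λ a → total-mono-≤ xs λ a′ → ≤R a a′) ⟩
  pairs (λ a a′ → total bools λ b → total bools λ b′ → R a a′ b b′)
    ≡⟨ expand Q ⟨
  total (vecs xs (suc m * 2)) (λ W → total (vecs bools (suc m * 2)) (Q W)) ∎
  where
  open ≤-Reasoning
  open +-*-Solver
  pairs : (A → A → ℕ) → ℕ
  pairs F = total xs λ a → total xs λ a′ → F a a′
  pairs-+ : ∀ F H → pairs (λ a a′ → F a a′ + H a a′) ≡ pairs F + pairs H
  pairs-+ F H = trans (total-cong xs λ a → total-+ xs (F a) (H a)) (total-+ xs _ _)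
  inner : (Vec A (m * 2) → Vec Bool (m * 2) → ℕ) → ℕ
  inner F = total (vecs xs (m * 2)) λ W → total (vecs bools (m * 2)) (F W)
  inner-cong : ∀ {F H} → (∀ W T → F W T ≡ H W T) → inner F ≡ inner H
  inner-cong eq = total-cong (vecs xs (m * 2)) λ W → total-cong (vecs bools (m * 2)) (eq W)
  section : A → A → Bool → Bool → Vec A (m * 2) → Vec Bool (m * 2) → ℕ
  section a a′ b b′ W T = Q (a ∷ a′ ∷ W) (b ∷ b′ ∷ T)
  R weighted : A → A → Bool → Bool → ℕ
  R a a′ b b′ = inner (section a a′ b b′)
  weighted a a′ b b′ = inner λ W T → section a a′ b b′ W T * weight {suc m} (b ∷ b′ ∷ T)
  falses : A → A → ℕ
  falses a a′ = R a a′ false false + R a a′ false true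
  by-induction : ∀ a a′ b b′ → inner (λ W T → section a a′ b b′ W T * weight {m} T) ≤ R a a′ b b′
  by-induction a a′ b b′ = symmetrization xs m (section a a′ b b′) (λ sw → inv (there sw))
  reversed : ∀ a a′ → R a a′ false true ≡ R a′ a true false
  reversed a a′ = inner-cong λ W T → inv here
  zero-inner : ∀ F → inner (λ W T → F W T * 0) ≡ 0
  zero-inner F = trans (inner-cong λ W T → *-zeroʳ (F W T))
    (trans (total-cong (vecs xs (m * 2)) λ W → trans (total-const (vecs bools (m * 2)) 0) (*-zeroʳ (length (vecs bools (m * 2)))))
      (trans (total-const (vecs xs (m * 2)) 0) (*-zeroʳ (length (vecs xs (m * 2))))))
  double-inner : ∀ F (H : Vec Bool (m * 2) → ℕ) → inner (λ W T → F W T * (H T + H T)) ≡ inner (λ W T → F W T * H T) + inner (λ W T → F W T * H T)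
  double-inner F H = trans (inner-cong λ W T → *-distribˡ-+ (F W T) (H T) (H T))
    (trans (total-cong (vecs xs (m * 2)) λ W → total-+ (vecs bools (m * 2)) _ _) (total-+ (vecs xs (m * 2)) _ _))
  weighted≤ : ∀ a a′ → (total bools λ b → total bools λ b′ → weighted a a′ b b′) ≤
    R a a′ false false + R a a′ false true + R a a′ false true
  weighted≤ a a′ = begin
    weighted a a′ false false + (weighted a a′ false true + 0) + (weighted a a′ true false + (weighted a a′ true true + 0) + 0)
      ≡⟨ cong₂ (λ x y → weighted a a′ false false + (weighted a a′ false true + 0) + (x + (y + 0) + 0))
           (zero-inner (section a a′ true false)) (zero-inner (section a a′ true true)) ⟩
    weighted a a′ false false + (weighted a a′ false true + 0) + 0
      ≡⟨ solve 2 (λ x y → x :+ (y :+ con 0) :+ con 0 := x :+ y) refl (weighted a a′ false false) (weighted a a′ false true) ⟩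
    weighted a a′ false false + weighted a a′ false true
      ≡⟨ cong (weighted a a′ false false +_) (double-inner (section a a′ false true) (weight {m})) ⟩
    weighted a a′ false false + (half + half)
      ≤⟨ +-mono-≤ (by-induction a a′ false false) (+-mono-≤ (by-induction a a′ false true) (by-induction a a′ false true)) ⟩
    R a a′ false false + (R a a′ false true + R a a′ false true)
      ≡⟨ +-assoc (R a a′ false false) _ _ ⟨
    R a a′ false false + R a a′ false true + R a a′ false true ∎
    where half = inner λ W T → section a a′ false true W T * weight {m} T
  ≤R : ∀ a a′ → R a a′ false false + R a a′ false true + R a a′ true false ≤
    (total bools λ b → total bools λ b′ → R a a′ b b′)
  ≤R a a′ = ≤-trans (m≤m+n _ (R a a′ true true)) (≤-reflexive
    (solve 4 (λ x y z w → x :+ y :+ z :+ w := x :+ (y :+ con 0) :+ (z :+ (w :+ con 0) :+ con 0)) refl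
      (R a a′ false false) (R a a′ false true) (R a a′ true false) (R a a′ true true)))
  expand : ∀ F → total (vecs xs (suc m * 2)) (λ W → total (vecs bools (suc m * 2)) (F W)) ≡
    pairs (λ a a′ → total bools λ b → total bools λ b′ → inner λ W T → F (a ∷ a′ ∷ W) (b ∷ b′ ∷ T))
  expand F = trans (total-vecs² xs (m * 2) _) (total-cong xs λ a → total-cong xs λ a′ →
    trans (total-cong (vecs xs (m * 2)) λ W → total-vecs² bools (m * 2) _)
    (trans (total-swap (vecs xs (m * 2)) bools λ W b → total bools λ b′ → total (vecs bools (m * 2)) λ T → F (a ∷ a′ ∷ W) (b ∷ b′ ∷ T))
      (total-cong bools λ b → total-swap (vecs xs (m * 2)) bools λ W b′ → total (vecs bools (m * 2)) λ T → F (a ∷ a′ ∷ W) (b ∷ b′ ∷ T))))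

-- The average factor 1 + |I|/n contributed by one ghost vertex, multiplied by n.
total-subset : ∀ {n} (I : Subset n) → total (allFin n) (λ y → if Vec.lookup I y then 2 else 1) ≡ n + ∣ I ∣
total-subset []      = refl
total-subset {suc n} (b ∷ I) = trans (cong ((if b then 2 else 1) +_) tail) (head b)
  where
  tail : total (tabulate suc) (λ y → if Vec.lookup (b ∷ I) y then 2 else 1) ≡ n + ∣ I ∣
  tail = trans (cong (λ ys → total ys (λ y → if Vec.lookup (b ∷ I) y then 2 else 1)) (sym (map-tabulate (λ i → i) suc)))
    (trans (cong sum (sym (map-∘ (allFin n)))) (total-subset I))
  head : ∀ b → (if b then 2 else 1) + (n + ∣ I ∣) ≡ suc n + ∣ b ∷ I ∣
  head true  = cong suc (sym (+-suc n ∣ I ∣))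
  head false = refl

-- As `Z` misses `I`, the weight is a product over the ghost entries, so the total factorises.
total-weight : ∀ {n m} (I : Subset n) (Z : Vec (Fin n) m) → (∀ i → Vec.lookup Z i ∉ₛ I) →
  total (vecs (allFin n) m) (λ Z′ → weight {m} (trace I (interleave Z Z′))) ≡ (n + ∣ I ∣) ^ m
total-weight         I []      missed = refl
total-weight {n} {suc m} I (z ∷ Z) missed = begin
  total (vecs (allFin n) (suc m)) (λ Z′ → weight {suc m} (trace I (interleave (z ∷ Z) Z′)))
    ≡⟨ total-vecs (allFin n) m _ ⟩
  total (allFin n) (λ y → total (vecs (allFin n) m) λ Z′ →
    weight {suc m} (Vec.lookup I z ∷ Vec.lookup I y ∷ trace I (interleave Z Z′)))
    ≡⟨ total-cong (allFin n) (λ y → step (Vec.lookup I z) (Vec.lookup I y) z∉I) ⟩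
  total (allFin n) (λ y → (if Vec.lookup I y then 2 else 1) * (n + ∣ I ∣) ^ m)
    ≡⟨ total-*ʳ (allFin n) _ ((n + ∣ I ∣) ^ m) ⟩
  total (allFin n) (λ y → if Vec.lookup I y then 2 else 1) * (n + ∣ I ∣) ^ m
    ≡⟨ cong (_* (n + ∣ I ∣) ^ m) (total-subset I) ⟩
  (n + ∣ I ∣) ^ suc m ∎
  where
  open ≡-Reasoning
  z∉I : Vec.lookup I z ≢ true
  z∉I eq = missed zero (Vec.lookup⇒[]= z I eq)
  ih = total-weight I Z (missed ∘ suc)
  step : ∀ b b′ → b ≢ true →
    total (vecs (allFin n) m) (λ Z′ → weight {suc m} (b ∷ b′ ∷ trace I (interleave Z Z′))) ≡
    (if b′ then 2 else 1) * (n + ∣ I ∣) ^ m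
  step true  _     b≢ = contradiction refl b≢
  step false false _  = trans ih (sym (*-identityˡ _))
  step false true  _  = trans (total-+ (vecs (allFin n) m) _ _)
    (cong₂ _+_ ih (trans ih (sym (+-identityʳ _))))

swap-sym : ∀ {A B : Set} {m} {W : Vec A (m * 2)} {T : Vec B (m * 2)} {W′ T′} →
  Swap {m = m} W T W′ T′ → Swap {m = m} W′ T′ W T
swap-sym here       = here
swap-sym (there sw) = there (swap-sym sw)

swap-trace : ∀ {n m} (I : Subset n) {W T W′ T′} → Swap {m = m} W T W′ T′ → trace I W ≡ T → trace I W′ ≡ T′
swap-trace I here       refl = refl
swap-trace {m = suc m} I (there {b = b} {b′} sw) eq with Vec.∷-injective eq
... | refl , eq′ with Vec.∷-injective eq′
...   | refl , eq″ = cong (λ T → b ∷ b′ ∷ T) (swap-trace {m = m} I sw eq″)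

-- Growth of powers of 1 + 1/D

-- Bernoulli's inequality (1 + 1/D)^j ≥ 1 + j/D with the denominators cleared; j = D gives
-- `doubling`.
bernoulli : ∀ D j → D ^ j * (D + j) ≤ D * suc D ^ j
bernoulli D zero    = ≤-reflexive (trans (*-identityˡ _) (trans (+-identityʳ D) (sym (*-identityʳ D))))
bernoulli D (suc j) = begin
  D * D ^ j * (D + suc j)          ≤⟨ m≤m+n _ (D ^ j * j) ⟩
  D * D ^ j * (D + suc j) + D ^ j * j
    ≡⟨ solve 3 (λ D j x → D :* x :* (D :+ (con 1 :+ j)) :+ x :* j := (con 1 :+ D) :* (x :* (D :+ j))) refl D j (D ^ j) ⟩
  suc D * (D ^ j * (D + j))        ≤⟨ *-monoʳ-≤ (suc D) (bernoulli D j) ⟩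
  suc D * (D * suc D ^ j)          ≡⟨ solve 2 (λ D x → (con 1 :+ D) :* (D :* x) := D :* ((con 1 :+ D) :* x)) refl D (suc D ^ j) ⟩
  D * suc D ^ suc j                ∎
  where
  open ≤-Reasoning
  open +-*-Solver

doubling : ∀ D .{{_ : NonZero D}} → 2 * D ^ D ≤ suc D ^ D
doubling D = *-cancelˡ-≤ D (≤-trans (≤-reflexive
  (solve 2 (λ D x → D :* (con 2 :* x) := x :* (D :+ D)) refl D (D ^ D))) (bernoulli D D))
  where open +-*-Solver

^-distrib-* : ∀ m n o → (m * n) ^ o ≡ m ^ o * n ^ o
^-distrib-* m n zero    = refl
^-distrib-* m n (suc o) = trans (cong (m * n *_) (^-distrib-* m n o))
  (solve 4 (λ m n x y → m :* n :* (x :* y) := m :* x :* (n :* y)) refl m n (m ^ o) (n ^ o))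
  where open +-*-Solver

-- The k-th power of `doubling` reads (1 + 1/D)^(D k) ≥ 2^k.
2^≤bound : ∀ {D k B} .{{_ : NonZero D}} → suc D ^ (D * k) ≤ D ^ (D * k) * B → 2 ^ k ≤ B
2^≤bound {D} {k} {B} le = *-cancelˡ-≤ (D ^ (D * k)) {{m^n≢0 D (D * k)}} (begin
  D ^ (D * k) * 2 ^ k     ≡⟨ *-comm (D ^ (D * k)) (2 ^ k) ⟩
  2 ^ k * D ^ (D * k)     ≡⟨ cong (2 ^ k *_) (^-*-assoc D D k) ⟨
  2 ^ k * (D ^ D) ^ k     ≡⟨ ^-distrib-* 2 (D ^ D) k ⟨
  (2 * D ^ D) ^ k         ≤⟨ ^-monoˡ-≤ k (doubling D) ⟩
  (suc D ^ D) ^ k         ≡⟨ ^-*-assoc (suc D) D k ⟩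
  suc D ^ (D * k)         ≤⟨ le ⟩
  D ^ (D * k) * B         ∎)
  where open ≤-Reasoning

^-cancelʳ-≤ : ∀ {a b} d .{{_ : NonZero d}} → a ^ d ≤ b ^ d → a ≤ b
^-cancelʳ-≤ d le = ≮⇒≥ λ lt → <⇒≱ (^-monoˡ-< d lt) le

-- The sampling bound for the hitting number

module Sampling {n : ℕ} (G : Graph n) where
  open Graph G
  open Matchings G
  open VC G

  independent? : Decidable (IsIndependent G)
  independent? S = Fin.all? λ u → Fin.all? λ v → (u ∈? S) →-dec ((v ∈? S) →-dec ¬? (u ~? v))

  maximum? : Decidable Maximum
  maximum? I = independent? I ×-dec
    map′ (λ none J ind → decidable-stable (∣ J ∣ ≤? ∣ I ∣) λ ≰ → none (J , ind , ≰))
         (λ max (J , ind , ≰) → ≰ (max J ind))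
         (¬? (anySubset? λ J → independent? J ×-dec ¬? (∣ J ∣ ≤? ∣ I ∣)))

  isTrace? : ∀ {N} (W : Vec (Fin n) N) → Decidable (IsTrace W)
  isTrace? W T = anySubset? λ I → maximum? I ×-dec Vec.≡-dec Bool._≟_ (trace I W) T

  traceCount : ∀ {N} → Vec (Fin n) N → Vec Bool N → ℕ
  traceCount W T = indicator (isTrace? W T)

  traceCount-invariant : ∀ m → SwapInvariant {m = m} traceCount
  traceCount-invariant m {W} {T} {W′} {T′} sw = cong (if_then 1 else 0)
    (does-⇔ (mk⇔ (λ (I , max , eq) → I , max , swap-trace {m = m} I sw eq)
                 (λ (I , max , eq) → I , max , swap-trace {m = m} I (swap-sym sw) eq))
      (isTrace? W T) (isTrace? W′ T′))

  module _ {D d m : ℕ} (1≤n : 1 ≤ n)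
           (missing : ∀ (Z : Vec (Fin n) m) → ∃ λ I → Maximum I × (∀ i → Vec.lookup Z i ∉ₛ I))
           (large : ∀ {I} → Maximum I → n ≤ D * ∣ I ∣)
           (notShattered : ∀ (W : Vec (Fin n) (m * 2)) S → ∣ S ∣ ≡ suc d → ¬ Shatters (IsTrace W) S) where

    private
      V = allFin n
      weighted : Vec (Fin n) (m * 2) → ℕ
      weighted W = total (vecs bools (m * 2)) λ T → traceCount W T * weight {m} T

    weighted≥ : ∀ W {I} → Maximum I → weight {m} (trace I W) ≤ weighted W
    weighted≥ W {I} max = begin
      weight {m} (trace I W)                                 ≡⟨ *-identityˡ _ ⟨
      1 * weight {m} (trace I W)                             ≡⟨ cong (λ b → (if b then 1 else 0) * weight {m} (trace I W))
                                                                  (dec-true (isTrace? W (trace I W)) (I , max , refl)) ⟨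
      traceCount W (trace I W) * weight {m} (trace I W)      ≤⟨ ∈⇒≤total (λ T → traceCount W T * weight {m} T) (∈-vecs ∈-bools (trace I W)) ⟩
      weighted W                                             ∎
      where open ≤-Reasoning

    -- The set missing `Z` alone supplies enough weight: n ≤ D |I| gives (D + 1) n ≤ D (n + |I|),
    -- which is raised to the power m.
    ghost≥ : ∀ Z → (suc D * n) ^ m ≤ total (vecs V m) (λ Z′ → weighted (interleave Z Z′)) * D ^ m
    ghost≥ Z with missing Z
    ... | I , max , missed = begin
      (suc D * n) ^ m                          ≤⟨ ^-monoˡ-≤ m (+-monoˡ-≤ (D * n) (large max)) ⟩
      (D * ∣ I ∣ + D * n) ^ m                  ≡⟨ cong (_^ m) (trans (+-comm (D * ∣ I ∣) _) (sym (*-distribˡ-+ D n ∣ I ∣))) ⟩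
      (D * (n + ∣ I ∣)) ^ m                    ≡⟨ trans (^-distrib-* D (n + ∣ I ∣) m) (*-comm (D ^ m) _) ⟩
      (n + ∣ I ∣) ^ m * D ^ m                  ≡⟨ cong (_* D ^ m) (total-weight I Z missed) ⟨
      total (vecs V m) (λ Z′ → weight {m} (trace I (interleave Z Z′))) * D ^ m
        ≤⟨ *-monoˡ-≤ (D ^ m) (total-mono-≤ (vecs V m) λ Z′ → weighted≥ (interleave Z Z′) max) ⟩
      total (vecs V m) (λ Z′ → weighted (interleave Z Z′)) * D ^ m ∎
      where open ≤-Reasoning

    length-V^ : ∀ k → length (vecs V k) ≡ n ^ k
    length-V^ k = trans (length-vecs V k) (cong (_^ k) (length-tabulate (λ i → i)))

    -- Counts the weighted traces over all n^(2m) double samples: from below by `ghost≥` for each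
    -- `Z`, from above by `symmetrization` and `sauer`.
    sampling : suc D ^ m ≤ D ^ m * suc (m * 2) ^ d
    sampling = *-cancelˡ-≤ (n ^ m * n ^ m) {{m*n≢0 (n ^ m) (n ^ m) {{n^m≢0}} {{n^m≢0}}}} (begin
      n ^ m * n ^ m * suc D ^ m
        ≡⟨ solve 2 (λ x y → x :* x :* y := x :* (y :* x)) refl (n ^ m) (suc D ^ m) ⟩
      n ^ m * (suc D ^ m * n ^ m)
        ≡⟨ cong₂ _*_ (length-V^ m) (^-distrib-* (suc D) n m) ⟨
      length (vecs V m) * (suc D * n) ^ m
        ≡⟨ total-const (vecs V m) _ ⟨
      total (vecs V m) (λ _ → (suc D * n) ^ m)
        ≤⟨ total-mono-≤ (vecs V m) ghost≥ ⟩
      total (vecs V m) (λ Z → total (vecs V m) (λ Z′ → weighted (interleave Z Z′)) * D ^ m)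
        ≡⟨ total-*ʳ (vecs V m) _ (D ^ m) ⟩
      total (vecs V m) (λ Z → total (vecs V m) (λ Z′ → weighted (interleave Z Z′))) * D ^ m
        ≡⟨ cong (_* D ^ m) (total-interleave V m weighted) ⟨
      total (vecs V (m * 2)) weighted * D ^ m
        ≤⟨ *-monoˡ-≤ (D ^ m) (symmetrization V m traceCount (traceCount-invariant m)) ⟩
      total (vecs V (m * 2)) (λ W → count (isTrace? W)) * D ^ m
        ≤⟨ *-monoˡ-≤ (D ^ m) (total-mono-≤ (vecs V (m * 2)) λ W → sauer (suc d) (isTrace? W) (notShattered W)) ⟩
      total (vecs V (m * 2)) (λ _ → suc (m * 2) ^ d) * D ^ m
        ≡⟨ cong (_* D ^ m) (total-const (vecs V (m * 2)) _) ⟩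
      length (vecs V (m * 2)) * suc (m * 2) ^ d * D ^ m
        ≡⟨ cong (λ x → x * suc (m * 2) ^ d * D ^ m) (trans (length-V^ (m * 2)) n^2m) ⟩
      n ^ m * n ^ m * suc (m * 2) ^ d * D ^ m
        ≡⟨ solve 3 (λ x y z → x :* x :* y :* z := x :* x :* (z :* y)) refl (n ^ m) (suc (m * 2) ^ d) (D ^ m) ⟩
      n ^ m * n ^ m * (D ^ m * suc (m * 2) ^ d) ∎)
      where
      open ≤-Reasoning
      open +-*-Solver
      n^m≢0 = m^n≢0 n m {{>-nonZero 1≤n}}
      n^2m : n ^ (m * 2) ≡ n ^ m * n ^ m
      n^2m = trans (sym (^-*-assoc n m 2)) (cong (n ^ m *_) (*-identityʳ (n ^ m)))

  -- Otherwise the entries of `Z` would form a hitting set with at most m < h elements.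
  missed-maximum : ∀ {m h} → IsHittingNumber G h → m < h → (Z : Vec (Fin n) m) →
    ∃ λ I → Maximum I × (∀ i → Vec.lookup Z i ∉ₛ I)
  missed-maximum {m} (_ , min) m<h Z
    with anySubset? (λ I → maximum? I ×-dec ¬? (nonempty? (fromList (tabulate (Vec.lookup Z)) ∩ I)))
  ... | yes (I , max , empty) = I , max , λ i zi∈I → empty (_ , x∈p∩q⁺ (∈-fromList⁺ (∈-tabulate⁺ i) , zi∈I))
  ... | no none = contradiction (min X hits) (<⇒≱ (≤-<-trans ∣X∣≤m m<h))
    where
    X = fromList (tabulate (Vec.lookup Z))
    ∣X∣≤m : ∣ X ∣ ≤ m
    ∣X∣≤m = ≤-trans (∣fromList∣≤ (tabulate (Vec.lookup Z))) (≤-reflexive (length-tabulate (Vec.lookup Z)))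
    hits : HitsMaximumIndependents G X
    hits S (ind , _ , max) = decidable-stable (nonempty? (X ∩ S)) λ empty → none (S , (ind , max) , empty)

  maximum-large : ∀ {ω s} → (∀ xs → AllPairs _~_ xs → length xs ≤ ω) → (∀ M → Matching M → length M ≢ suc s) →
    ∀ {I} → Maximum I → n ≤ (ω * ω) ^ s * ∣ I ∣
  maximum-large {s = s} clique≤ noMatching {I} (_ , max) = ≤-trans (≤-reflexive (sym (length-tabulate (λ i → i))))
    (Wagon.length-bound clique≤ independent≤ s (allFin n) (allFin⁺ n) (λ M m _ → noMatching M m))
    where
    independent≤ : ∀ xs → Unique xs → (∀ {u v} → u ∈ xs → v ∈ xs → u ≁ v) → length xs ≤ ∣ I ∣
    independent≤ xs u ind = subst (_≤ ∣ I ∣) (∣fromList∣ u)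
      (max (fromList xs) λ x y x∈ y∈ → ind (∈-fromList⁻ xs x∈) (∈-fromList⁻ xs y∈))

  clique-list≤ : ∀ {ω} → IsCliqueNumber G ω → ∀ xs → AllPairs _~_ xs → length xs ≤ ω
  clique-list≤ (_ , max) xs cl = subst (_≤ _) (∣fromList∣ (AllPairs.map (λ e eq → ~-irrefl eq e) cl))
    (max (fromList xs) λ u v u∈ v∈ → AllPairs-∈ ~-sym cl (∈-fromList⁻ xs u∈) (∈-fromList⁻ xs v∈))

  -- If m < h, then `sampling` with m = D d q yields 2^(d q) ≤ (1 + 2m)^d, and taking d-th roots
  -- contradicts the choice of q.
  hitting≤ : ∀ {ω s h q} → (∀ M → Matching M → length M ≢ suc s) →
    IsCliqueNumber G ω → IsHittingNumber G h → 1 ≤ n → 1 ≤ ω → 1 ≤ s →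
    let m = (ω * ω) ^ s * (s * ω ^ s * q) in suc (m * 2) < 2 ^ q → h ≤ m
  hitting≤ {ω} {s} {h} {q} noMatching cliqueω hits 1≤n 1≤ω 1≤s lt = ≮⇒≥ λ m<h → <⇒≱ lt
    (^-cancelʳ-≤ d (≤-trans (≤-reflexive (trans (^-*-assoc 2 q d) (cong (2 ^_) (*-comm q d))))
      (2^≤bound {k = d * q} (sampling 1≤n (missed-maximum hits m<h) (maximum-large clique≤ noMatching)
        λ W S eq sh → <⇒≱ (≤-reflexive (sym eq)) (shattered-size clique≤ noMatching W sh)))))
    where
    d = s * ω ^ s
    clique≤ = clique-list≤ cliqueω
    instance
      ω≢0 : NonZero ω
      ω≢0 = >-nonZero 1≤ω
      ω²≢0 : NonZero (ω * ω)
      ω²≢0 = m*n≢0 ω ω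
      D≢0 : NonZero ((ω * ω) ^ s)
      D≢0 = m^n≢0 (ω * ω) s
      d≢0 : NonZero d
      d≢0 = m*n≢0 s (ω ^ s) {{>-nonZero 1≤s}} {{m^n≢0 ω s}}

-- The logarithm and the choice of parameters

0≤recip : ∀ k → 0ℚ ℚ.≤ ℤ.+ 1 / suc k
0≤recip k = ℚ.<⇒≤ (ℚ.positive⁻¹ (ℤ.+ 1 / suc k) {{pos-recip k}})

∑-prefix-≤ : ∀ k l {f} → (∀ j → 0ℚ ℚ.≤ f j) → ∑ k f ℚ.≤ ∑ (k + l) f
∑-prefix-≤ k l {f} 0≤f = ℚ.≤-trans
  (ℚ.≤-trans (ℚ.≤-reflexive (sym (ℚ.+-identityʳ (∑ k f)))) (ℚ.+-monoʳ-≤ (∑ k f) (0≤∑ l)))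
  (ℚ.≤-reflexive (sym (∑-++ k l f)))
  where
  0≤∑ : ∀ l → 0ℚ ℚ.≤ ∑ l (λ j → f (k + j))
  0≤∑ zero    = ℚ.≤-refl
  0≤∑ (suc l) = ℚ.+-mono-≤ (0≤∑ l) (0≤f (k + l))

-- Each of the p + 1 terms is at least 1/(2p + 2); this is the discrete form of the bound 1/2 for
-- the integral of 1/x over [x , 2x].
½≤octave : ∀ p → ½ ℚ.≤ ∑ (suc p) (λ j → ℤ.+ 1 / suc (p + j))
½≤octave p = ℚ.≤-trans
  (ℚ.≤-reflexive (sym (trans (∑-const (suc p) (ℤ.+ 1 / suc (p + 1 * suc p))) (suc*recip p 1))))
  (∑-mono (suc p) λ j j<1+p → recip-anti (+-monoʳ-≤ p (≤-trans (<⇒≤ j<1+p) (≤-reflexive (sym (*-identityˡ (suc p)))))))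

-- Each doubling of the argument adds one octave. The form `suc A` lets the truncated subtraction in
-- `logSum` compute.
logSum-2^-≥ : ∀ ℓ A i → suc A ≡ 2 ^ ℓ → (ℤ.+ ℓ / 1) ℚ.* ½ ℚ.≤ logSum (suc A) i
logSum-2^-≥ zero    zero i _ = ℚ.≤-refl
logSum-2^-≥ (suc ℓ) A i eq with 2 ^ ℓ in 2^ℓ
... | zero  = contradiction 2^ℓ (≢-nonZero⁻¹ (2 ^ ℓ) {{m^n≢0 2 ℓ}})
... | suc B rewrite suc-injective (trans eq (cong (suc B +_) (+-identityʳ (suc B)))) = begin
  (ℤ.+ suc ℓ / 1) ℚ.* ½                            ≡⟨ ∑-const (suc ℓ) ½ ⟨
  ∑ ℓ (λ _ → ½) ℚ.+ ½                            ≡⟨ cong (ℚ._+ ½) (∑-const ℓ ½) ⟩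
  -- With p = i + B (i + 1) the octave has p + 1 = (B + 1)(i + 1) terms.
  (ℤ.+ ℓ / 1) ℚ.* ½ ℚ.+ ½                          ≤⟨ ℚ.+-mono-≤ (logSum-2^-≥ ℓ B i (sym 2^ℓ)) (½≤octave (i + B * suc i)) ⟩
  ∑ (B * suc i) f ℚ.+ ∑ (suc B * suc i) (λ j → ℤ.+ 1 / suc (i + B * suc i + j))
    ≡⟨ cong (∑ (B * suc i) f ℚ.+_) (∑-cong (suc B * suc i) λ j → cong (λ k → ℤ.+ 1 / suc k) (+-assoc i (B * suc i) j)) ⟩
  ∑ (B * suc i) f ℚ.+ ∑ (suc B * suc i) (λ j → f (B * suc i + j))
    ≡⟨ ∑-++ (B * suc i) (suc B * suc i) f ⟨
  ∑ (B * suc i + suc B * suc i) f                ≡⟨ cong (λ k → ∑ k f) (*-distribʳ-+ (suc i) B (suc B)) ⟨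
  ∑ ((B + suc B) * suc i) f                      ∎
  where
  open ℚ.≤-Reasoning
  f = λ j → ℤ.+ 1 / suc (i + j)

logSum-≥ : ∀ ℓ {ω} i → 2 ^ ℓ ≤ ω → (ℤ.+ ℓ / 1) ℚ.* ½ ℚ.≤ logSum ω i
logSum-≥ ℓ {ω} i le with 2 ^ ℓ in 2^ℓ | m≤n⇒∃[o]m+o≡n le
... | zero  | _ = contradiction 2^ℓ (≢-nonZero⁻¹ (2 ^ ℓ) {{m^n≢0 2 ℓ}})
... | suc A | r , refl = ℚ.≤-trans (logSum-2^-≥ ℓ A i (sym 2^ℓ)) (subst (λ k → ∑ (A * suc i) f ℚ.≤ ∑ k f)
    (sym (*-distribʳ-+ (suc i) A r)) (∑-prefix-≤ (A * suc i) (r * suc i) (λ j → 0≤recip (i + j))))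
  where f = λ j → ℤ.+ 1 / suc (i + j)

-- Every Riemann sum for log ω is already at least ℓ/2, so the inequality holds from index 0 on
-- without using ε.
fromℕ≤·log : ∀ {h c ω} ℓ → 2 ^ ℓ ≤ ω → h * 2 ≤ c * ℓ → fromℕ h ≤ℝ c · log ω
fromℕ≤·log {h} {c} {ω} ℓ 2^ℓ≤ω le ε 0<ε = 0 , λ i _ → begin
  ℤ.+ h / 1                                    ≤⟨ fromℚᵘ-mono-≤ (mkℚᵘ (ℤ.+ h) 0) C*L (*≤* num) ⟩
  ℚ.fromℚᵘ C*L                               ≡⟨ fromℚᵘ-homo-* (mkℚᵘ (ℤ.+ c) 0) L ⟨
  (ℤ.+ c / 1) ℚ.* ℚ.fromℚᵘ L                   ≡⟨ cong ((ℤ.+ c / 1) ℚ.*_) (fromℚᵘ-homo-* (mkℚᵘ (ℤ.+ ℓ) 0) (mkℚᵘ (ℤ.+ 1) 1)) ⟨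
  (ℤ.+ c / 1) ℚ.* ((ℤ.+ ℓ / 1) ℚ.* ½)            ≤⟨ ℚ.*-monoˡ-≤-nonNeg (ℤ.+ c / 1) {{nonNeg-fromℕ c}} (logSum-≥ ℓ i 2^ℓ≤ω) ⟩
  (ℤ.+ c / 1) ℚ.* logSum ω i                   ≡⟨ ℚ.+-identityʳ _ ⟨
  (ℤ.+ c / 1) ℚ.* logSum ω i ℚ.+ 0ℚ            ≤⟨ ℚ.+-monoʳ-≤ ((ℤ.+ c / 1) ℚ.* logSum ω i) (ℚ.<⇒≤ 0<ε) ⟩
  (ℤ.+ c / 1) ℚ.* logSum ω i ℚ.+ ε             ∎
  where
  open ℚ.≤-Reasoning
  L = mkℚᵘ (ℤ.+ ℓ) 0 ℚᵘ.* mkℚᵘ (ℤ.+ 1) 1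
  C*L = mkℚᵘ (ℤ.+ c) 0 ℚᵘ.* L
  num : ℤ.+ h ℤ.* ℤ.+ 2 ℤ.≤ ℤ.+ c ℤ.* (ℤ.+ ℓ ℤ.* ℤ.+ 1) ℤ.* ℤ.+ 1
  num = subst₂ ℤ._≤_ (ℤ.pos-* h 2)
    (trans (ℤ.pos-* c ℓ) (sym (trans (ℤ.*-identityʳ _) (cong (ℤ.+ c ℤ.*_) (ℤ.*-identityʳ (ℤ.+ ℓ))))))
    (ℤ.+≤+ le)

binary-magnitude : ∀ ω → 1 ≤ ω → ∃ λ ℓ → 2 ^ ℓ ≤ ω × ω < 2 ^ suc ℓ
binary-magnitude (suc zero)    _ = 0 , ≤-refl , ≤-refl
binary-magnitude (suc (suc k)) _ with binary-magnitude (suc k) (s≤s z≤n)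
... | ℓ , lo , hi with 2 ^ suc ℓ ≤? suc (suc k)
...   | no  ≰  = ℓ , m≤n⇒m≤1+n lo , ≰⇒> ≰
...   | yes le = suc ℓ , le , ≤-<-trans hi (^-monoʳ-< 2 ≤-refl (n<1+n (suc ℓ)))

-- Absorbs the factors s of d and q into t^t. At s = 1 it is an equality; for s ≥ 2 the cube of 1 +
-- s suffices.
4s²≤[1+s]^[1+s] : ∀ s → 4 * (s * s) ≤ suc s ^ suc s
4s²≤[1+s]^[1+s] 0 = z≤n
4s²≤[1+s]^[1+s] 1 = ≤-refl
4s²≤[1+s]^[1+s] s@(suc r@(suc _)) = begin
  4 * (s * s)                                             ≤⟨ m≤m+n _ (r * (s * s) + (1 + 3 * s)) ⟩
  4 * (s * s) + (r * (s * s) + (1 + 3 * s))               ≡⟨ solve 1 (λ r → let s = con 1 :+ r in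
    con 4 :* (s :* s) :+ (r :* (s :* s) :+ (con 1 :+ con 3 :* s)) := (con 1 :+ s) :* ((con 1 :+ s) :* ((con 1 :+ s) :* con 1))) refl r ⟩
  suc s ^ 3                                               ≤⟨ ^-monoʳ-≤ (suc s) {3} {suc s} (s≤s (s≤s (s≤s z≤n))) ⟩
  suc s ^ suc s                                           ∎
  where
  open ≤-Reasoning
  open +-*-Solver

n≤2^n : ∀ n → n ≤ 2 ^ n
n≤2^n zero    = z≤n
n≤2^n (suc n) = +-mono-≤ (m^n>0 2 n) (≤-trans (n≤2^n n) (≤-reflexive (sym (+-identityʳ (2 ^ n)))))

module Parameters {s ℓ ω : ℕ} (1≤s : 1 ≤ s) (1≤ℓ : 1 ≤ ℓ) (ω<2^1+ℓ : ω < 2 ^ suc ℓ) where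

  private
    u = s * ℓ
    E = 2 ^ u
    q = 20 * u
    m = (ω * ω) ^ s * (s * ω ^ s * q)

  1≤u : 1 ≤ u
  1≤u = *-mono-≤ 1≤s 1≤ℓ

  -- As ℓ ≥ 1, ω < 2^(ℓ + 1) ≤ 2^(2ℓ). Expressing all quantities through E = 2^(s ℓ) reduces the
  -- choice of q to comparing exponents.
  ω^s≤E² : ω ^ s ≤ E ^ 2
  ω^s≤E² = begin
    ω ^ s              ≤⟨ ^-monoˡ-≤ s (≤-trans (<⇒≤ ω<2^1+ℓ) (^-monoʳ-≤ 2 (+-mono-≤ 1≤ℓ (≤-reflexive (sym (+-identityʳ ℓ)))))) ⟩
    (2 ^ (2 * ℓ)) ^ s  ≡⟨ ^-*-assoc 2 (2 * ℓ) s ⟩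
    2 ^ (2 * ℓ * s)    ≡⟨ cong (2 ^_) (solve 2 (λ ℓ s → con 2 :* ℓ :* s := s :* ℓ :* con 2) refl ℓ s) ⟩
    2 ^ (u * 2)        ≡⟨ ^-*-assoc 2 u 2 ⟨
    E ^ 2              ∎
    where
    open ≤-Reasoning
    open +-*-Solver

  m≤20E^8 : m ≤ 20 * E ^ 8
  m≤20E^8 = begin
    (ω * ω) ^ s * (s * ω ^ s * q)        ≡⟨ cong (_* (s * ω ^ s * q)) (^-distrib-* ω ω s) ⟩
    ω ^ s * ω ^ s * (s * ω ^ s * q)      ≤⟨ *-mono-≤ (*-mono-≤ ω^s≤E² ω^s≤E²)
                                              (*-mono-≤ (*-mono-≤ s≤E ω^s≤E²) (*-monoʳ-≤ 20 (n≤2^n u))) ⟩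
    E ^ 2 * E ^ 2 * (E * E ^ 2 * (20 * E)) ≡⟨ solve 1 (λ e →
      e :^ 2 :* e :^ 2 :* (e :* e :^ 2 :* (con 20 :* e)) := con 20 :* e :^ 8) refl E ⟩
    20 * E ^ 8                           ∎
    where
    open ≤-Reasoning
    open +-*-Solver
    s≤E : s ≤ E
    s≤E = ≤-trans (m≤m*n s ℓ {{>-nonZero 1≤ℓ}}) (n≤2^n u)

  1+2m<2^q : suc (m * 2) < 2 ^ q
  1+2m<2^q = begin-strict
    suc (m * 2)             ≤⟨ +-mono-≤ (m^n>0 E {{m^n≢0 2 u}} 8) (*-monoˡ-≤ 2 m≤20E^8) ⟩
    E ^ 8 + 20 * E ^ 8 * 2  ≡⟨ solve 1 (λ x → x :+ con 20 :* x :* con 2 := x :* con 41) refl (E ^ 8) ⟩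
    -- Since E ≥ 2, E^12 ≥ 4096 = 42 + 4054. The exponents 8 + 12 account for the 20 in q.
    E ^ 8 * 41              <⟨ *-monoʳ-< (E ^ 8) {{m^n≢0 E 8 {{m^n≢0 2 u}}}} (≤-trans (m≤m+n 42 4054) (^-monoˡ-≤ 12 (^-monoʳ-≤ 2 1≤u))) ⟩
    E ^ 8 * E ^ 12          ≡⟨ ^-distribˡ-+-* E 8 12 ⟨
    E ^ 20                  ≡⟨ ^-*-assoc 2 u 20 ⟩
    2 ^ (u * 20)            ≡⟨ cong (2 ^_) (*-comm u 20) ⟩
    2 ^ q                   ∎
    where
    open ≤-Reasoning
    open +-*-Solver

  -- The left side is 40 s² ω^(3s) ℓ; its factor 2 compensates for log ω being bounded below by ℓ/2
  -- only.
  2m≤ : m * 2 ≤ 10 * suc s ^ suc s * ω ^ (3 * suc s ∸ 3) * ℓ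
  2m≤ = begin
    (ω * ω) ^ s * (s * ω ^ s * q) * 2    ≡⟨ cong (λ x → x * (s * ω ^ s * q) * 2) (^-distrib-* ω ω s) ⟩
    ω ^ s * ω ^ s * (s * ω ^ s * q) * 2  ≡⟨ solve 3 (λ s ℓ x → x :* x :* (s :* x :* (con 20 :* (s :* ℓ))) :* con 2
      := con 10 :* (con 4 :* (s :* s)) :* (x :* x :* x) :* ℓ) refl s ℓ (ω ^ s) ⟩
    10 * (4 * (s * s)) * (ω ^ s * ω ^ s * ω ^ s) * ℓ
      ≤⟨ *-monoˡ-≤ ℓ (*-monoˡ-≤ (ω ^ s * ω ^ s * ω ^ s) (*-monoʳ-≤ 10 (4s²≤[1+s]^[1+s] s))) ⟩
    10 * suc s ^ suc s * (ω ^ s * ω ^ s * ω ^ s) * ℓ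
      ≡⟨ cong (λ x → 10 * suc s ^ suc s * x * ℓ) ω^ ⟨
    10 * suc s ^ suc s * ω ^ (3 * suc s ∸ 3) * ℓ ∎
    where
    open ≤-Reasoning
    open +-*-Solver
    ω^ : ω ^ (3 * suc s ∸ 3) ≡ ω ^ s * ω ^ s * ω ^ s
    ω^ = trans (cong (ω ^_) (trans (cong (_∸ 3) (solve 1 (λ s → con 3 :* (con 1 :+ s) := con 3 :+ (s :+ s :+ s)) refl s))
        (m+n∸m≡n 3 (s + s + s))))
      (trans (^-distribˡ-+-* ω (s + s) s) (cong (_* ω ^ s) (^-distribˡ-+-* ω s s)))

-- The case t = 1 and the final bound

module _ {n : ℕ} (G : Graph n) where
  open Matchings G

  -- Two vertices of a maximum clique span an edge, which is an induced matching of size 1.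
  edge-matching : ∀ {ω} → IsCliqueNumber G ω → 2 ≤ ω → InducedMatching G 1
  edge-matching ((S , clique , refl) , _) 2≤ω
    with elements S | length-elements S | elements-∈ S | elements-unique S
  ... | []        | eq | _ | _ = contradiction (subst (2 ≤_) (sym eq) 2≤ω) λ ()
  ... | _ ∷ []    | eq | _ | _ = contradiction (subst (2 ≤_) (sym eq) 2≤ω) λ { (s≤s ()) }
  ... | x ∷ y ∷ _ | _  | x∈S ∷ y∈S ∷ _ | (x≢y ∷ _) ∷ _ =
    inducedMatching ((x , y) ∷ []) (clique x y x∈S y∈S x≢y ∷ [] , [] ∷ [])

-- For ω = 1 the right-hand side would be 0, whereas an edgeless nonempty graph has h = 1; hence
-- `2 ≤ ω`.
theorem1p2 : (t : ℕ) → 1 ≤ t → (n : ℕ) (G : Graph n) → ¬ InducedMatching G t →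
    (ω h : ℕ) → IsCliqueNumber G ω → IsHittingNumber G h → 2 ≤ ω →
    fromℕ h ≤ℝ (10 * t ^ t * ω ^ (3 * t ∸ 3)) · log ω
theorem1p2 (suc zero) _ n G none ω h cliqueω hits 2≤ω = contradiction (edge-matching G cliqueω 2≤ω) none
theorem1p2 (suc s@(suc _)) _ n G none ω h cliqueω@((S , _ , ∣S∣≡ω) , _) hits 2≤ω =
  let ℓ , 2^ℓ≤ω , ω<2^1+ℓ = binary-magnitude ω (<⇒≤ 2≤ω) in
  fromℕ≤·log {h} {10 * suc s ^ suc s * ω ^ (3 * suc s ∸ 3)} ℓ 2^ℓ≤ω (bound ℓ ω<2^1+ℓ)
  where
  open Matchings G
  1≤n : 1 ≤ n
  1≤n = ≤-trans (<⇒≤ 2≤ω) (subst (_≤ n) ∣S∣≡ω (∣p∣≤n S))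
  noMatching : ∀ M → Matching M → length M ≢ suc s
  noMatching M matching eq = none (subst (InducedMatching G) eq (inducedMatching M matching))
  bound : ∀ ℓ → ω < 2 ^ suc ℓ → h * 2 ≤ 10 * suc s ^ suc s * ω ^ (3 * suc s ∸ 3) * ℓ
  -- `Parameters` assumes ℓ ≥ 1; ℓ = 0 would mean ω < 2.
  bound zero      ω<2 = contradiction 2≤ω (<⇒≱ ω<2)
  bound ℓ@(suc _) ω<2^1+ℓ = ≤-trans
    (*-monoˡ-≤ 2 (Sampling.hitting≤ G {s = s} {q = 20 * (s * ℓ)} noMatching cliqueω hits 1≤n (<⇒≤ 2≤ω) (s≤s z≤n) 1+2m<2^q))
    2m≤
    where open Parameters {s} {ℓ} {ω} (s≤s z≤n) (s≤s z≤n) ω<2^1+ℓ
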